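{- Let $\Gamma=\mathrm{PSL}_2(\mathbb{Z})$. The map $G\mapsto(Y_{\mathrm{comb}}(G),\mathbf{r}_G)$ induces a bijection between the set of subgroups of $\Gamma$ and the set of isomorphism classes of pointed bipartite cuboid graphs. In particular, for a subgroup $G\subset\Gamma$, the quotient of the set $\mathrm{Edge}(Y_{\mathrm{comb}}(G))$ by the group $\mathrm{Aut}(Y_{\mathrm{comb}}(G))$ of the automorphisms of $Y_{\mathrm{comb}}(G)$ that preserve the bipartite cuboid structure is in bijection with the conjugacy class of $G$; so $G$ is normal in $\Gamma$ if and only if $\mathrm{Aut}(Y_{\mathrm{comb}}(G))$ acts transitively on $\mathrm{Edge}(Y_{\mathrm{comb}}(G))$.
   Context: A bipartite cuboid graph is a graph (possibly infinite, multiple edges allowed) such that: the vertices are subdivided into two types; the vertices of one type, called (0), can have valency 1 or 2; the vertices of the other type, called (1), can have valency 1 or 3; any edge joins a vertex of one type with a vertex of the other type; and there is a cyclic order on the set of the edges meeting at a vertex of valency 3. A pointed bipartite cuboid graph is the data of a bipartite cuboid graph and an edge of the graph. Isomorphisms (and automorphisms) of bipartite cuboid graphs are graph isomorphisms preserving the types of vertices and the cyclic orders; isomorphisms of pointed graphs also take the chosen edge to the chosen edge. Let $G_0,G_1\subset\Gamma$ be the subgroups of order 2 and 3 generated by the classes of $\left(\begin{smallmatrix}0&-1\\1&0\end{smallmatrix}\right)$ and $u=\left(\begin{smallmatrix}0&1\\-1&1\end{smallmatrix}\right)$ respectively. For a subgroup $G\subset\Gamma$, $\Gamma$ acts on the right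 on the set $G\backslash\Gamma$ of cosets $Gx$. The bipartite cuboid graph $Y_{\mathrm{comb}}(G)$ has as vertices of type (0) the $G_0$-orbits in $G\backslash\Gamma$, as vertices of type (1) the $G_1$-orbits in $G\backslash\Gamma$, and $\mathrm{Edge}(Y_{\mathrm{comb}}(G))=G\backslash\Gamma$; the edge $x\in G\backslash\Gamma$ joins the $G_0$-orbit of $x$ with the $G_1$-orbit of $x$. The cyclic order on the edges at a trivalent vertex, i.e. a 3-element $G_1$-orbit containing $x$, is $x,\ xu,\ xu^2$. The distinguished edge $\mathbf{r}_G$ is the coset $G\in G\backslash\Gamma$.
   Formalization: Bipartite cuboid graphs are required to be connected; without this the bijection fails, since a disjoint union of two such graphs satisfies the stated definition but is never isomorphic to a (necessarily connected) Y_comb(G). -}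

module Defs where

open import Algebra.Bundles using (Group)
import Algebra.Properties.Group as GroupProperties
open import Data.Fin.Base using (Fin)
open import Data.Integer.Base using (ℤ; _+_; _-_; _*_; -_; 0ℤ; 1ℤ; -1ℤ)
open import Data.Integer.Properties using (neg-involutive)
open import Data.Integer.Tactic.RingSolver using (solve-∀)
open import Data.Nat.Base using (ℕ)
open import Data.Product.Base using (Σ; ∃; _×_; _,_; proj₁; proj₂)
open import Data.Sum.Base using (_⊎_; inj₁; inj₂)
open import Function.Bundles using (Func; Inverse; _⇔_; mk⇔; Equivalence)
import Function.Construct.Composition as Compose
import Function.Construct.Identity as Identity
import Function.Construct.Symmetry as Symmetry
open import Level using (0ℓ) renaming (suc to lsuc)
open import Relation.Binary.Bundles using (Setoid)
import Relation.Binary.Construct.On as On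
open import Relation.Binary.Construct.Closure.Equivalence using (EqClosure)
open import Relation.Binary.PropositionalEquality as ≡
  using (_≡_; refl; cong; cong₂)
import Relation.Binary.Reasoning.Setoid as SetoidReasoning
open import Relation.Nullary.Negation.Core using (¬_)
open import Relation.Unary using (Pred; _∈_; _≐_)

------------------------------------------------------------------------
-- The modular group PSL₂(ℤ)

record Mat₂ : Set where
  constructor mat
  field
    a b c d : ℤ

mat-cong : ∀ {a b c d a′ b′ c′ d′} → a ≡ a′ → b ≡ b′ → c ≡ c′ → d ≡ d′ →
           mat a b c d ≡ mat a′ b′ c′ d′
mat-cong refl refl refl refl = refl

infixl 7 _·_
infix  8 -ᴹ_

_·_ : Mat₂ → Mat₂ → Mat₂
mat a b c d · mat a′ b′ c′ d′ =
  mat (a * a′ + b * c′) (a * b′ + b * d′) (c * a′ + d * c′) (c * b′ + d * d′)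

-ᴹ_ : Mat₂ → Mat₂
-ᴹ mat a b c d = mat (- a) (- b) (- c) (- d)

1ᴹ : Mat₂
1ᴹ = mat 1ℤ 0ℤ 0ℤ 1ℤ

adj : Mat₂ → Mat₂
adj (mat a b c d) = mat d (- b) (- c) a

det : Mat₂ → ℤ
det (mat a b c d) = a * d - b * c

record SL₂ℤ : Set where
  constructor sl
  field
    matrix : Mat₂
    det≡1  : det matrix ≡ 1ℤ

open SL₂ℤ

private
  abstract
    det-· : ∀ M N → det (M · N) ≡ det M * det N
    det-· (mat a b c d) (mat a′ b′ c′ d′) = eq a b c d a′ b′ c′ d′
      where
      eq : ∀ a b c d a′ b′ c′ d′ →
           (a * a′ + b * c′) * (c * b′ + d * d′) - (a * b′ + b * d′) * (c * a′ + d * c′)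
           ≡ (a * d - b * c) * (a′ * d′ - b′ * c′)
      eq = solve-∀

    det-adj : ∀ M → det (adj M) ≡ det M
    det-adj (mat a b c d) = eq a b c d
      where
      eq : ∀ a b c d → d * a - - b * - c ≡ a * d - b * c
      eq = solve-∀

    -ᴹ-involutive : ∀ M → -ᴹ (-ᴹ M) ≡ M
    -ᴹ-involutive (mat a b c d) =
      mat-cong (neg-involutive a) (neg-involutive b) (neg-involutive c) (neg-involutive d)

    ·-assoc : ∀ L M N → (L · M) · N ≡ L · (M · N)
    ·-assoc (mat a b c d) (mat a′ b′ c′ d′) (mat a″ b″ c″ d″) =
      mat-cong (eq a b a′ b′ c′ d′ a″ c″) (eq a b a′ b′ c′ d′ b″ d″)
               (eq c d a′ b′ c′ d′ a″ c″) (eq c d a′ b′ c′ d′ b″ d″)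
      where
      eq : ∀ p q a b c d x y →
           (p * a + q * c) * x + (p * b + q * d) * y
           ≡ p * (a * x + b * y) + q * (c * x + d * y)
      eq = solve-∀

    ·-identityˡ : ∀ M → 1ᴹ · M ≡ M
    ·-identityˡ (mat a b c d) = mat-cong (eq₁ a c) (eq₁ b d) (eq₂ a c) (eq₂ b d)
      where
      eq₁ : ∀ x y → 1ℤ * x + 0ℤ * y ≡ x
      eq₁ = solve-∀
      eq₂ : ∀ x y → 0ℤ * x + 1ℤ * y ≡ y
      eq₂ = solve-∀

    ·-identityʳ : ∀ M → M · 1ᴹ ≡ M
    ·-identityʳ (mat a b c d) = mat-cong (eq₁ a b) (eq₂ a b) (eq₁ c d) (eq₂ c d)
      where
      eq₁ : ∀ x y → x * 1ℤ + y * 0ℤ ≡ x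
      eq₁ = solve-∀
      eq₂ : ∀ x y → x * 0ℤ + y * 1ℤ ≡ y
      eq₂ = solve-∀

    ·-adj : ∀ M → det M ≡ 1ℤ → M · adj M ≡ 1ᴹ
    ·-adj (mat a b c d) δ =
      mat-cong (≡.trans (eq₁ a b c d) δ) (eq₂ a b) (eq₃ c d) (≡.trans (eq₄ a b c d) δ)
      where
      eq₁ : ∀ a b c d → a * d + b * - c ≡ a * d - b * c
      eq₁ = solve-∀
      eq₂ : ∀ a b → a * - b + b * a ≡ 0ℤ
      eq₂ = solve-∀
      eq₃ : ∀ c d → c * d + d * - c ≡ 0ℤ
      eq₃ = solve-∀
      eq₄ : ∀ a b c d → c * - b + d * a ≡ a * d - b * c
      eq₄ = solve-∀

    adj-· : ∀ M → det M ≡ 1ℤ → adj M · M ≡ 1ᴹ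
    adj-· (mat a b c d) δ =
      mat-cong (≡.trans (eq₁ a b c d) δ) (eq₂ b d) (eq₃ a c) (≡.trans (eq₄ a b c d) δ)
      where
      eq₁ : ∀ a b c d → d * a + - b * c ≡ a * d - b * c
      eq₁ = solve-∀
      eq₂ : ∀ b d → d * b + - b * d ≡ 0ℤ
      eq₂ = solve-∀
      eq₃ : ∀ a c → - c * a + a * c ≡ 0ℤ
      eq₃ = solve-∀
      eq₄ : ∀ a b c d → - c * b + a * d ≡ a * d - b * c
      eq₄ = solve-∀

    -ᴹ-distribˡ-· : ∀ M N → (-ᴹ M) · N ≡ -ᴹ (M · N)
    -ᴹ-distribˡ-· (mat a b c d) (mat a′ b′ c′ d′) =
      mat-cong (eq a b a′ c′) (eq a b b′ d′) (eq c d a′ c′) (eq c d b′ d′)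
      where
      eq : ∀ p q x y → - p * x + - q * y ≡ - (p * x + q * y)
      eq = solve-∀

    -ᴹ-distribʳ-· : ∀ M N → M · (-ᴹ N) ≡ -ᴹ (M · N)
    -ᴹ-distribʳ-· (mat a b c d) (mat a′ b′ c′ d′) =
      mat-cong (eq a b a′ c′) (eq a b b′ d′) (eq c d a′ c′) (eq c d b′ d′)
      where
      eq : ∀ p q x y → p * - x + q * - y ≡ - (p * x + q * y)
      eq = solve-∀

-- The quotient by {±1} is taken by changing the equality of SL₂(ℤ).
data _≈±_ (M N : SL₂ℤ) : Set where
  same : matrix M ≡ matrix N → M ≈± N
  opp  : matrix M ≡ -ᴹ matrix N → M ≈± N

PSL₂ℤ : Group 0ℓ 0ℓ
PSL₂ℤ = record
  { Carrier = SL₂ℤ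
  ; _≈_     = _≈±_
  ; _∙_     = _∙_
  ; ε       = sl 1ᴹ refl
  ; _⁻¹     = _⁻¹
  ; isGroup = record
    { isMonoid = record
      { isSemigroup = record
        { isMagma = record
          { isEquivalence = record { refl = same refl ; sym = sym± ; trans = trans± }
          ; ∙-cong = ∙-cong
          }
        ; assoc = λ L M N → same (·-assoc (matrix L) (matrix M) (matrix N))
        }
      ; identity = (λ M → same (·-identityˡ (matrix M)))
                 , (λ M → same (·-identityʳ (matrix M)))
      }
    ; inverse = (λ M → same (adj-· (matrix M) (det≡1 M)))
              , (λ M → same (·-adj (matrix M) (det≡1 M)))
    ; ⁻¹-cong = ⁻¹-cong
    }
  }
  where
  _∙_ : SL₂ℤ → SL₂ℤ → SL₂ℤ
  sl M δ ∙ sl N δ′ = sl (M · N) (≡.trans (det-· M N) (cong₂ _*_ δ δ′))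

  _⁻¹ : SL₂ℤ → SL₂ℤ
  sl M δ ⁻¹ = sl (adj M) (≡.trans (det-adj M) δ)

  sym± : ∀ {M N} → M ≈± N → N ≈± M
  sym± (same p) = same (≡.sym p)
  sym± {M} {N} (opp p) = opp (≡.sym (≡.trans (cong -ᴹ_ p) (-ᴹ-involutive (matrix N))))

  trans± : ∀ {L M N} → L ≈± M → M ≈± N → L ≈± N
  trans± (same p) (same q) = same (≡.trans p q)
  trans± (same p) (opp q)  = opp (≡.trans p q)
  trans± (opp p)  (same q) = opp (≡.trans p (cong -ᴹ_ q))
  trans± {N = N} (opp p) (opp q) =
    same (≡.trans p (≡.trans (cong -ᴹ_ q) (-ᴹ-involutive (matrix N))))

  ∙-cong : ∀ {M M′ N N′} → M ≈± M′ → N ≈± N′ → (M ∙ N) ≈± (M′ ∙ N′)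
  ∙-cong (same p) (same q) = same (cong₂ _·_ p q)
  ∙-cong {M′ = M′} {N′ = N′} (same p) (opp q) =
    opp (≡.trans (cong₂ _·_ p q) (-ᴹ-distribʳ-· (matrix M′) (matrix N′)))
  ∙-cong {M′ = M′} {N′ = N′} (opp p) (same q) =
    opp (≡.trans (cong₂ _·_ p q) (-ᴹ-distribˡ-· (matrix M′) (matrix N′)))
  ∙-cong {M′ = M′} {N′ = N′} (opp p) (opp q) =
    same (≡.trans (cong₂ _·_ p q)
         (≡.trans (-ᴹ-distribˡ-· (matrix M′) (-ᴹ matrix N′))
         (≡.trans (cong -ᴹ_ (-ᴹ-distribʳ-· (matrix M′) (matrix N′)))
                  (-ᴹ-involutive (matrix M′ · matrix N′)))))

  ⁻¹-cong : ∀ {M N} → M ≈± N → (M ⁻¹) ≈± (N ⁻¹)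
  ⁻¹-cong (same p) = same (cong adj p)
  ⁻¹-cong (opp p)  = opp (cong adj p)

s u : SL₂ℤ
s = sl (mat 0ℤ -1ℤ 1ℤ 0ℤ) refl
u = sl (mat 0ℤ 1ℤ -1ℤ 1ℤ) refl

------------------------------------------------------------------------
-- Subgroups, cosets and conjugates

module Subgroups (Γ : Group 0ℓ 0ℓ) where

  open Group Γ renaming (refl to ≈-refl; sym to ≈-sym; trans to ≈-trans)
  open GroupProperties Γ
  open SetoidReasoning setoid

  record Subgroup : Set₁ where
    field
      member    : Pred Carrier 0ℓ
      resp      : ∀ {x y} → x ≈ y → x ∈ member → y ∈ member
      ε-closed  : ε ∈ member
      ∙-closed  : ∀ {x y} → x ∈ member → y ∈ member → x ∙ y ∈ member
      ⁻¹-closed : ∀ {x} → x ∈ member → x ⁻¹ ∈ member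

  open Subgroup

  infix 4 _≐ₛ_
  _≐ₛ_ : Subgroup → Subgroup → Set
  H ≐ₛ K = member H ≐ member K

  data Generated (g : Carrier) : Pred Carrier 0ℓ where
    gen  : g ∈ Generated g
    rep  : ∀ {x y} → x ≈ y → x ∈ Generated g → y ∈ Generated g
    unit : ε ∈ Generated g
    mul  : ∀ {x y} → x ∈ Generated g → y ∈ Generated g → x ∙ y ∈ Generated g
    inv  : ∀ {x} → x ∈ Generated g → x ⁻¹ ∈ Generated g

  ⟨_⟩ : Carrier → Subgroup
  ⟨ g ⟩ = record
    { member = Generated g ; resp = rep ; ε-closed = unit
    ; ∙-closed = mul ; ⁻¹-closed = inv }

  module _ (G : Subgroup) where

    private
      cancel-mid : ∀ x y g → (x ∙ g) ∙ (y ∙ g) ⁻¹ ≈ x ∙ y ⁻¹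
      cancel-mid x y g = begin
        (x ∙ g) ∙ (y ∙ g) ⁻¹      ≈⟨ ∙-congˡ (⁻¹-anti-homo-∙ y g) ⟩
        (x ∙ g) ∙ (g ⁻¹ ∙ y ⁻¹)   ≈⟨ assoc x g _ ⟩
        x ∙ (g ∙ (g ⁻¹ ∙ y ⁻¹))   ≈⟨ ∙-congˡ (assoc g (g ⁻¹) (y ⁻¹)) ⟨
        x ∙ ((g ∙ g ⁻¹) ∙ y ⁻¹)   ≈⟨ ∙-congˡ (∙-congʳ (inverseʳ g)) ⟩
        x ∙ (ε ∙ y ⁻¹)            ≈⟨ ∙-congˡ (identityˡ (y ⁻¹)) ⟩
        x ∙ y ⁻¹                  ∎

    -- The element x stands for the coset Gx.
    Cosets : Setoid 0ℓ 0ℓ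
    Cosets = record
      { Carrier       = Carrier
      ; _≈_           = λ x y → x ∙ y ⁻¹ ∈ member G
      ; isEquivalence = record
        { refl  = λ {x} → resp G (≈-sym (inverseʳ x)) (ε-closed G)
        ; sym   = λ {x} {y} p → resp G (begin
            (x ∙ y ⁻¹) ⁻¹      ≈⟨ ⁻¹-anti-homo-∙ x (y ⁻¹) ⟩
            y ⁻¹ ⁻¹ ∙ x ⁻¹     ≈⟨ ∙-congʳ (⁻¹-involutive y) ⟩
            y ∙ x ⁻¹           ∎) (⁻¹-closed G p)
        ; trans = λ {x} {y} {z} p q → resp G (begin
            (x ∙ y ⁻¹) ∙ (y ∙ z ⁻¹)   ≈⟨ assoc x (y ⁻¹) _ ⟩
            x ∙ (y ⁻¹ ∙ (y ∙ z ⁻¹))   ≈⟨ ∙-congˡ (assoc (y ⁻¹) y (z ⁻¹)) ⟨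
            x ∙ ((y ⁻¹ ∙ y) ∙ z ⁻¹)   ≈⟨ ∙-congˡ (∙-congʳ (inverseˡ y)) ⟩
            x ∙ (ε ∙ z ⁻¹)            ≈⟨ ∙-congˡ (identityˡ (z ⁻¹)) ⟩
            x ∙ z ⁻¹                  ∎) (∙-closed G p q)
        }
      }

    private module C = Setoid Cosets

    Cosets-reflexive : ∀ {x y} → x ≈ y → x C.≈ y
    Cosets-reflexive {x} {y} p =
      resp G (≈-sym (≈-trans (∙-congʳ p) (inverseʳ y))) (ε-closed G)

    -- The right action Gx ↦ Gxg is well defined.
    Cosets-actʳ : ∀ g {x y} → x C.≈ y → (x ∙ g) C.≈ (y ∙ g)
    Cosets-actʳ g {x} {y} = resp G (≈-sym (cancel-mid x y g))

    Orbits : Subgroup → Setoid 0ℓ 0ℓ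
    Orbits K = record
      { Carrier       = Carrier
      ; _≈_           = λ x y → ∃ λ k → k ∈ member K × (x ∙ k) C.≈ y
      ; isEquivalence = record
        { refl  = λ {x} → ε , ε-closed K , Cosets-reflexive (identityʳ x)
        ; sym   = λ { {x} {y} (k , k∈K , p) → k ⁻¹ , ⁻¹-closed K k∈K ,
            C.trans (C.sym (Cosets-actʳ (k ⁻¹) p)) (Cosets-reflexive (begin
              (x ∙ k) ∙ k ⁻¹   ≈⟨ assoc x k (k ⁻¹) ⟩
              x ∙ (k ∙ k ⁻¹)   ≈⟨ ∙-congˡ (inverseʳ k) ⟩
              x ∙ ε            ≈⟨ identityʳ x ⟩
              x                ∎)) }
        ; trans = λ { {x} (k , k∈K , p) (l , l∈K , q) → k ∙ l , ∙-closed K k∈K l∈K ,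
            C.trans (Cosets-reflexive (≈-sym (assoc x k l)))
                    (C.trans (Cosets-actʳ l p) q) }
        }
      }

    orbit : (K : Subgroup) → Func Cosets (Orbits K)
    orbit K = record
      { to   = λ x → x
      ; cong = λ {x} p →
          ε , ε-closed K , C.trans (Cosets-reflexive (identityʳ x)) p
      }

  IsNormal : Subgroup → Set
  IsNormal G = ∀ g {x} → x ∈ member G → g ∙ x ∙ g ⁻¹ ∈ member G

  -- The subgroup gGg⁻¹.
  conjugate : Carrier → Subgroup → Subgroup
  conjugate g G = record
    { member    = λ x → ∃ λ h → h ∈ member G × x ≈ g ∙ h ∙ g ⁻¹
    ; resp      = λ { x≈y (h , h∈G , p) → h , h∈G , ≈-trans (≈-sym x≈y) p }
    ; ε-closed  = ε , ε-closed G ,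
        ≈-sym (≈-trans (∙-congʳ (identityʳ g)) (inverseʳ g))
    ; ∙-closed  = λ { {x} {y} (h , h∈G , p) (k , k∈G , q) →
        h ∙ k , ∙-closed G h∈G k∈G , (begin
          x ∙ y                                    ≈⟨ ∙-cong p q ⟩
          (g ∙ h ∙ g ⁻¹) ∙ (g ∙ k ∙ g ⁻¹)          ≈⟨ ∙-congˡ (assoc g k (g ⁻¹)) ⟩
          (g ∙ h ∙ g ⁻¹) ∙ (g ∙ (k ∙ g ⁻¹))        ≈⟨ assoc (g ∙ h) (g ⁻¹) _ ⟩
          (g ∙ h) ∙ (g ⁻¹ ∙ (g ∙ (k ∙ g ⁻¹)))      ≈⟨ ∙-congˡ (assoc (g ⁻¹) g _) ⟨
          (g ∙ h) ∙ ((g ⁻¹ ∙ g) ∙ (k ∙ g ⁻¹))      ≈⟨ ∙-congˡ (∙-congʳ (inverseˡ g)) ⟩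
          (g ∙ h) ∙ (ε ∙ (k ∙ g ⁻¹))               ≈⟨ ∙-congˡ (identityˡ _) ⟩
          (g ∙ h) ∙ (k ∙ g ⁻¹)                     ≈⟨ assoc (g ∙ h) k (g ⁻¹) ⟨
          (g ∙ h) ∙ k ∙ g ⁻¹                       ≈⟨ ∙-congʳ (assoc g h k) ⟩
          g ∙ (h ∙ k) ∙ g ⁻¹                       ∎) }
    ; ⁻¹-closed = λ { {x} (h , h∈G , p) → h ⁻¹ , ⁻¹-closed G h∈G , (begin
          x ⁻¹                        ≈⟨ ⁻¹-cong p ⟩
          (g ∙ h ∙ g ⁻¹) ⁻¹           ≈⟨ ⁻¹-anti-homo-∙ (g ∙ h) (g ⁻¹) ⟩
          g ⁻¹ ⁻¹ ∙ (g ∙ h) ⁻¹        ≈⟨ ∙-cong (⁻¹-involutive g) (⁻¹-anti-homo-∙ g h) ⟩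
          g ∙ (h ⁻¹ ∙ g ⁻¹)           ≈⟨ assoc g (h ⁻¹) (g ⁻¹) ⟨
          g ∙ h ⁻¹ ∙ g ⁻¹             ∎) }
    }

  ConjugacyClass : Subgroup → Setoid (lsuc 0ℓ) 0ℓ
  ConjugacyClass G = record
    { Carrier       = Σ Subgroup λ H → ∃ λ g → H ≐ₛ conjugate g G
    ; _≈_           = λ H K → proj₁ H ≐ₛ proj₁ K
    ; isEquivalence = record
      { refl  = (λ p → p) , (λ p → p)
      ; sym   = λ (f , g) → g , f
      ; trans = λ (f , g) (f′ , g′) → (λ p → f′ (f p)) , (λ p → g (g′ p))
      }
    }

------------------------------------------------------------------------
-- Bipartite cuboid graphs

record IsCyclicOrder (A : Setoid 0ℓ 0ℓ)
  (R : Setoid.Carrier A → Setoid.Carrier A → Setoid.Carrier A → Set) : Set where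
  open Setoid A using (_≉_)
  field
    cyclic     : ∀ {x y z} → R x y z → R y z x
    asymmetric : ∀ {x y z} → R x y z → ¬ R z y x
    transitive : ∀ {x y z w} → R x y z → R x z w → R x y w
    connected  : ∀ {x y z} → x ≉ y → y ≉ z → z ≉ x → R x y z ⊎ R z y x

-- Cyclic a b c is only meaningful when a, b, c are edges at a common trivalent
-- vertex; no condition is put on it elsewhere and isomorphisms ignore it there.
record BipartiteGraph : Set₁ where
  field
    Vertex₀ Vertex₁ Edge : Setoid 0ℓ 0ℓ
    end₀ : Func Edge Vertex₀
    end₁ : Func Edge Vertex₁

  open Setoid Edge using (_≈_) renaming (Carrier to E)
  open Setoid Vertex₀ using () renaming (Carrier to V₀; _≈_ to _≈₀_)
  open Setoid Vertex₁ using () renaming (Carrier to V₁; _≈_ to _≈₁_)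

  field
    Cyclic      : E → E → E → Set
    Cyclic-resp : ∀ {a b c a′ b′ c′} → a ≈ a′ → b ≈ b′ → c ≈ c′ →
                  Cyclic a b c → Cyclic a′ b′ c′

  Star₀ : V₀ → Setoid 0ℓ 0ℓ
  Star₀ v = On.setoid Edge (proj₁ {B = λ e → Func.to end₀ e ≈₀ v})

  Star₁ : V₁ → Setoid 0ℓ 0ℓ
  Star₁ v = On.setoid Edge (proj₁ {B = λ e → Func.to end₁ e ≈₁ v})

  HasValency₀ : V₀ → ℕ → Set
  HasValency₀ v n = Inverse (≡.setoid (Fin n)) (Star₀ v)

  HasValency₁ : V₁ → ℕ → Set
  HasValency₁ v n = Inverse (≡.setoid (Fin n)) (Star₁ v)

  CyclicAt : (v : V₁) (a b c : Setoid.Carrier (Star₁ v)) → Set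
  CyclicAt v (a , _) (b , _) (c , _) = Cyclic a b c

  data Adjacent : V₀ ⊎ V₁ → V₀ ⊎ V₁ → Set where
    joined : ∀ e {v w} → Func.to end₀ e ≈₀ v → Func.to end₁ e ≈₁ w →
             Adjacent (inj₁ v) (inj₂ w)

  Connected : Set
  Connected = ∀ v w → EqClosure Adjacent v w

record IsBipartiteCuboid (Y : BipartiteGraph) : Set where
  open BipartiteGraph Y
  field
    connected   : Connected
    valency₀    : ∀ v → HasValency₀ v 1 ⊎ HasValency₀ v 2
    valency₁    : ∀ v → HasValency₁ v 1 ⊎ HasValency₁ v 3
    cyclicOrder : ∀ v → HasValency₁ v 3 → IsCyclicOrder (Star₁ v) (CyclicAt v)

record PointedBipartiteCuboidGraph : Set₁ where
  constructor pointed
  field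
    graph             : BipartiteGraph
    isBipartiteCuboid : IsBipartiteCuboid graph
    root              : Setoid.Carrier (BipartiteGraph.Edge graph)

infix 4 _≅_ _≅•_

record _≅_ (Y Z : BipartiteGraph) : Set where
  private
    module Y = BipartiteGraph Y
    module Z = BipartiteGraph Z
  field
    vertex₀ : Inverse Y.Vertex₀ Z.Vertex₀
    vertex₁ : Inverse Y.Vertex₁ Z.Vertex₁
    edge    : Inverse Y.Edge Z.Edge

  onVertex₀ = Inverse.to vertex₀
  onVertex₁ = Inverse.to vertex₁
  onEdge    = Inverse.to edge

  field
    end₀-comm : ∀ e → Setoid._≈_ Z.Vertex₀
                  (Func.to Z.end₀ (onEdge e)) (onVertex₀ (Func.to Y.end₀ e))
    end₁-comm : ∀ e → Setoid._≈_ Z.Vertex₁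
                  (Func.to Z.end₁ (onEdge e)) (onVertex₁ (Func.to Y.end₁ e))
    cyclic-⇔  : ∀ v → Y.HasValency₁ v 3 →
                ∀ ((a , _) (b , _) (c , _) : Setoid.Carrier (Y.Star₁ v)) →
                Y.Cyclic a b c ⇔ Z.Cyclic (onEdge a) (onEdge b) (onEdge c)

module _ {Y Z : BipartiteGraph} (φ : Y ≅ Z) where
  private
    module Y  = BipartiteGraph Y
    module Z  = BipartiteGraph Z
    module E  = Setoid Y.Edge
    module E′ = Setoid Z.Edge
    module V  = Setoid Y.Vertex₁
    module V′ = Setoid Z.Vertex₁
    module V₀  = Setoid Y.Vertex₀
    module V₀′ = Setoid Z.Vertex₀
  open _≅_ φ
  private
    module I₀ = Inverse vertex₀
    module I₁ = Inverse vertex₁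
    module I  = Inverse edge

    end₀-comm⁻¹ : ∀ e → Func.to Y.end₀ (I.from e) V₀.≈ I₀.from (Func.to Z.end₀ e)
    end₀-comm⁻¹ e = V₀.sym (I₀.inverseʳ (V₀′.trans
      (Func.cong Z.end₀ (E′.sym (I.strictlyInverseˡ e))) (end₀-comm (I.from e))))

    end₁-comm⁻¹ : ∀ e → Func.to Y.end₁ (I.from e) V.≈ I₁.from (Func.to Z.end₁ e)
    end₁-comm⁻¹ e = V.sym (I₁.inverseʳ (V′.trans
      (Func.cong Z.end₁ (E′.sym (I.strictlyInverseˡ e))) (end₁-comm (I.from e))))

  Star₁-map : ∀ v → Inverse (Y.Star₁ v) (Z.Star₁ (onVertex₁ v))
  Star₁-map v = record
    { to        = λ (e , p) → I.to e , V′.trans (end₁-comm e) (I₁.to-cong p)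
    ; from      = λ (e , p) → I.from e , V.trans (end₁-comm⁻¹ e) (I₁.inverseʳ p)
    ; to-cong   = I.to-cong
    ; from-cong = I.from-cong
    ; inverse   = I.inverseˡ , I.inverseʳ
    }

  Star₁-map⁻¹ : ∀ v → Inverse (Z.Star₁ v) (Y.Star₁ (I₁.from v))
  Star₁-map⁻¹ v = record
    { to        = λ (e , p) → I.from e , V.trans (end₁-comm⁻¹ e) (I₁.from-cong p)
    ; from      = λ (e , p) → I.to e , V′.trans (end₁-comm e) (I₁.inverseˡ p)
    ; to-cong   = I.from-cong
    ; from-cong = I.to-cong
    ; inverse   = I.inverseʳ , I.inverseˡ
    }

  ≅-sym : Z ≅ Y
  ≅-sym = record
    { vertex₀   = Symmetry.inverse vertex₀
    ; vertex₁   = Symmetry.inverse vertex₁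
    ; edge      = Symmetry.inverse edge
    ; end₀-comm = end₀-comm⁻¹
    ; end₁-comm = end₁-comm⁻¹
    ; cyclic-⇔  = λ v val a b c →
        let star = Inverse.to (Star₁-map⁻¹ v)
            eq   = cyclic-⇔ (I₁.from v) (Compose.inverse val (Star₁-map⁻¹ v))
                            (star a) (star b) (star c)
            tofrom = I.strictlyInverseˡ
            fromto = λ e → E′.sym (I.strictlyInverseˡ e)
        in mk⇔
          (λ p → Equivalence.from eq (Z.Cyclic-resp
                   (fromto (proj₁ a)) (fromto (proj₁ b)) (fromto (proj₁ c)) p))
          (λ p → Z.Cyclic-resp (tofrom (proj₁ a)) (tofrom (proj₁ b)) (tofrom (proj₁ c))
                   (Equivalence.to eq p))
    }

≅-refl : ∀ {Y} → Y ≅ Y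
≅-refl {Y} = record
  { vertex₀   = Identity.inverse Vertex₀
  ; vertex₁   = Identity.inverse Vertex₁
  ; edge      = Identity.inverse Edge
  ; end₀-comm = λ _ → Setoid.refl Vertex₀
  ; end₁-comm = λ _ → Setoid.refl Vertex₁
  ; cyclic-⇔  = λ _ _ _ _ _ → mk⇔ (λ p → p) (λ p → p)
  }
  where open BipartiteGraph Y

≅-trans : ∀ {X Y Z} → X ≅ Y → Y ≅ Z → X ≅ Z
≅-trans {X} {Y} {Z} φ ψ = record
  { vertex₀   = Compose.inverse φ.vertex₀ ψ.vertex₀
  ; vertex₁   = Compose.inverse φ.vertex₁ ψ.vertex₁
  ; edge      = Compose.inverse φ.edge ψ.edge
  ; end₀-comm = λ e → Setoid.trans Z.Vertex₀ (ψ.end₀-comm (φ.onEdge e))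
                        (Inverse.to-cong ψ.vertex₀ (φ.end₀-comm e))
  ; end₁-comm = λ e → Setoid.trans Z.Vertex₁ (ψ.end₁-comm (φ.onEdge e))
                        (Inverse.to-cong ψ.vertex₁ (φ.end₁-comm e))
  ; cyclic-⇔  = λ v val a b c →
      let star = Inverse.to (Star₁-map φ v)
      in Compose.equivalence (φ.cyclic-⇔ v val a b c)
           (ψ.cyclic-⇔ (φ.onVertex₁ v) (Compose.inverse val (Star₁-map φ v))
                       (star a) (star b) (star c))
  }
  where
  module φ = _≅_ φ
  module ψ = _≅_ ψ
  module Z = BipartiteGraph Z

_≅•_ : PointedBipartiteCuboidGraph → PointedBipartiteCuboidGraph → Set
pointed Y _ r ≅• pointed Z _ r′ =
  Σ (Y ≅ Z) λ φ → Setoid._≈_ (BipartiteGraph.Edge Z) (_≅_.onEdge φ r) r′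

Aut : BipartiteGraph → Set
Aut Y = Y ≅ Y

module _ (Y : BipartiteGraph) where
  open BipartiteGraph Y
  open Setoid Edge using (_≈_) renaming (Carrier to E)

  -- Edges in the same orbit of the automorphism group.
  SameOrbit : E → E → Set
  SameOrbit e e′ = ∃ λ (α : Aut Y) → _≅_.onEdge α e ≈ e′

  Edge/Aut : Setoid 0ℓ 0ℓ
  Edge/Aut = record
    { Carrier       = E
    ; _≈_           = SameOrbit
    ; isEquivalence = record
      { refl  = ≅-refl , Setoid.refl Edge
      ; sym   = λ (α , p) → ≅-sym α , Inverse.inverseʳ (_≅_.edge α) (Setoid.sym Edge p)
      ; trans = λ (α , p) (β , q) → ≅-trans α β ,
                  Setoid.trans Edge (Inverse.to-cong (_≅_.edge β) p) q
      }
    }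

  AutActsTransitively : Set
  AutActsTransitively = ∀ e e′ → SameOrbit e e′

------------------------------------------------------------------------
-- The graph of a subgroup of the modular group

open Subgroups PSL₂ℤ public

G₀ G₁ : Subgroup
G₀ = ⟨ s ⟩
G₁ = ⟨ u ⟩

Ycomb : Subgroup → BipartiteGraph
Ycomb G = record
  { Vertex₀     = Orbits G G₀
  ; Vertex₁     = Orbits G G₁
  ; Edge        = Cosets G
  ; end₀        = orbit G G₀
  ; end₁        = orbit G G₁
  ; Cyclic      = λ x y z → y ≈ x ∙ u × z ≈ x ∙ (u ∙ u)
  ; Cyclic-resp = λ {a} {b} {c} {a′} {b′} {c′} a≈a′ b≈b′ c≈c′ (p , q) →
      trans (sym b≈b′) (trans p (Cosets-actʳ G u a≈a′)) ,
      trans (sym c≈c′) (trans q (Cosets-actʳ G (u ∙ u) a≈a′))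
  }
  where
  open Group PSL₂ℤ using (_∙_)
  open Setoid (Cosets G) using (_≈_; sym; trans)

rootEdge : (G : Subgroup) → Setoid.Carrier (BipartiteGraph.Edge (Ycomb G))
rootEdge G = Group.ε PSL₂ℤ

{-# OPTIONS --safe #-}
module Submission where

-- A bipartite cuboid graph is the same thing as a transitive right Γ-set: s sends an
-- edge to the other edge at its vertex of type (0), and u to the next edge in the cyclic
-- order at its vertex of type (1). That σ² = τ³ = 1 suffices for an action of Γ is the
-- statement that Γ is the free product of ⟨s⟩ and ⟨u⟩. It is proved by ping-pong: a
-- word reduces to s^b p u^i with p a product of the matrices us and u²s, which have
-- nonnegative entries. Isomorphisms of the graphs are the isomorphisms of the Γ-sets, so an
-- edge is determined up to isomorphism by its stabiliser. The stabiliser of Gx is x⁻¹Gx.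

open import Defs
open import Algebra.Bundles using (Group)
import Algebra.Properties.Group as GroupProperties
open import Axiom.ExcludedMiddle using (ExcludedMiddle)
open import Data.Bool.Base using (Bool; true; false; not)
open import Data.Empty using (⊥-elim)
open import Data.Fin.Base using (Fin; zero; suc; toℕ; opposite)
open import Data.Integer.Base using (ℤ; +_; -[1+_]; +[1+_]; _+_; _-_; _*_; -_; 0ℤ; 1ℤ; -1ℤ; ∣_∣)
import Data.Integer.Properties as ℤ
open import Data.Integer.Tactic.RingSolver using (solve-∀)
open import Data.List.Base using (List; []; _∷_; _++_; length; replicate)
open import Data.Nat.Base as ℕ using (ℕ; zero; suc; _≤_; z≤n; s≤s)
import Data.Nat.Properties as ℕ
open import Data.Product using (Σ; Σ-syntax; ∃; _×_; _,_; proj₁; proj₂)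
open import Data.Product.Function.NonDependent.Propositional using (_×-⇔_)
open import Data.Sum.Base as Sum using (_⊎_; inj₁; inj₂)
open import Function.Base using (case_of_)
open import Function.Bundles using (Func; Inverse; _⇔_; mk⇔; Equivalence; Bijection)
import Function.Construct.Composition as Compose
import Function.Construct.Symmetry as Symmetry
open import Function.Properties.Bijection using (Bijection⇒Inverse)
open import Function.Structures using (IsBijection)
open import Level using (0ℓ)
open import Relation.Binary.Bundles using (Setoid)
open import Relation.Binary.Construct.Closure.Equivalence as EqClosure using (EqClosure)
open import Relation.Binary.Construct.Closure.ReflexiveTransitive using (_◅◅_) renaming (ε to []*; _◅_ to _∷*_)
open import Relation.Binary.Construct.Closure.Symmetric using (fwd; bwd)
import Relation.Binary.Construct.On as On
open import Relation.Binary.PropositionalEquality as ≡ using (_≡_; _≢_; refl; cong)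
import Relation.Binary.Reasoning.Setoid as SetoidReasoning
open import Relation.Binary.Structures using (IsEquivalence)
open import Relation.Nullary.Decidable.Core using (yes; no)
open import Relation.Nullary.Negation.Core using (¬_)
open import Relation.Unary using (_∈_)
open import Relation.Unary.Properties using (≐-refl; ≐-sym; ≐-trans)

open SL₂ℤ
open Subgroup
open Group PSL₂ℤ
  using (_≈_; _∙_; ε; _⁻¹; assoc; identityˡ; identityʳ; inverseˡ; inverseʳ; ∙-cong; ∙-congˡ; ∙-congʳ; ⁻¹-cong)
  renaming (Carrier to Γ; setoid to Γ-setoid; refl to ≈-refl; sym to ≈-sym; trans to ≈-trans)
open GroupProperties PSL₂ℤ using (\\-leftDividesʳ; ⁻¹-involutive; inverseʳ-unique; ε⁻¹≈ε)

-- A cuboid graph supplies only the two permutations, so letting an element g of Γ act takes a word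
-- for g as well as independence of the chosen word. The word comes from the subtractive Euclidean
-- algorithm on the first column of the matrix; independence is what ping-pong gives. Connectedness
-- of the graph amounts to transitivity of the action, and the vertices are recovered as the orbits
-- of `G₀` and `G₁`, so a map of edges determines the maps of vertices. At a vertex of type (1) with
-- a single edge the relation `Cyclic` is arbitrary, which is why arguments about u treat the two
-- valencies apart. Excluded middle enters through the valencies of `Ycomb G`: whether s fixes the
-- coset Gx is the question whether x s x⁻¹ lies in G, and likewise for u.

-- Words in s and u and their normal forms

data Letter : Set where
  S U : Letter

Word : Set
Word = List Letter

inverse : Word → Word
inverse []      = []
inverse (S ∷ w) = inverse w ++ S ∷ []
inverse (U ∷ w) = inverse w ++ U ∷ U ∷ []

data Syllable : Set where
  L R : Syllable

spell : List Syllable → Word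
spell []      = []
spell (L ∷ p) = U ∷ S ∷ spell p
spell (R ∷ p) = U ∷ U ∷ S ∷ spell p

-- A normal form s^b p u^i, with p a product of syllables L = us and R = u²s.
record NormalForm : Set where
  constructor nf
  field
    leading   : Bool
    syllables : List Syllable
    trailing  : Fin 3

⌊_⌋ : NormalForm → Word
⌊ nf false p i ⌋ = spell p ++ replicate (toℕ i) U
⌊ nf true  p i ⌋ = S ∷ ⌊ nf false p i ⌋

-- Prepending u to L = us gives R = u²s; prepending it to R gives u³s, which cancels to a leading s.
-- With no syllable left, the trailing exponent changes modulo 3.
cons : Letter → NormalForm → NormalForm
cons S (nf b p i)                   = nf (not b) p i
cons U (nf true  p i)               = nf false (L ∷ p) i
cons U (nf false (L ∷ p) i)         = nf false (R ∷ p) i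
cons U (nf false (R ∷ p) i)         = nf true p i
cons U (nf false [] zero)           = nf false [] (suc zero)
cons U (nf false [] (suc zero))     = nf false [] (suc (suc zero))
cons U (nf false [] (suc (suc _)))  = nf false [] zero

normalise : Word → NormalForm
normalise []      = nf false [] zero
normalise (l ∷ w) = cons l (normalise w)

-- Applied both to the edges of a graph and to Γ itself under right multiplication. In the second
-- case a word acting on `ε` yields its value, so a single normalisation lemma serves both.
module WordAction (X : Setoid 0ℓ 0ℓ) (σ τ : Func X X) where
  private module X = Setoid X
  open Func using (to) renaming (cong to to-cong)

  letter : Letter → Func X X
  letter S = σ
  letter U = τ

  act : X.Carrier → Word → X.Carrier
  act x []      = x
  act x (l ∷ w) = act (to (letter l) x) w

  act-cong : ∀ w {x y} → x X.≈ y → act x w X.≈ act y w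
  act-cong []      x≈y = x≈y
  act-cong (l ∷ w) x≈y = act-cong w (to-cong (letter l) x≈y)

  act-++ : ∀ v w {x} → act x (v ++ w) ≡ act (act x v) w
  act-++ []      w = refl
  act-++ (l ∷ v) w = act-++ v w

  module _ (σ² : ∀ x → to σ (to σ x) X.≈ x)
           (τ³ : ∀ x → to τ (to τ (to τ x)) X.≈ x) where

    act-inverse : ∀ w {x} → act x (w ++ inverse w) X.≈ x
    act-inverse []          = X.refl
    act-inverse (S ∷ w) {x} = begin
      act (to σ x) (w ++ inverse w ++ S ∷ [])      ≡⟨ step ⟩
      to σ (act (to σ x) (w ++ inverse w))         ≈⟨ to-cong σ (act-inverse w) ⟩
      to σ (to σ x)                                ≈⟨ σ² x ⟩
      x                                            ∎
      where
      open SetoidReasoning X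
      step : act (to σ x) (w ++ inverse w ++ S ∷ []) ≡ to σ (act (to σ x) (w ++ inverse w))
      step rewrite act-++ w (inverse w ++ S ∷ []) {to σ x}
                 | act-++ (inverse w) (S ∷ []) {act (to σ x) w}
                 | act-++ w (inverse w) {to σ x} = refl
    act-inverse (U ∷ w) {x} = begin
      act (to τ x) (w ++ inverse w ++ U ∷ U ∷ [])  ≡⟨ step ⟩
      to τ (to τ (act (to τ x) (w ++ inverse w)))  ≈⟨ to-cong τ (to-cong τ (act-inverse w)) ⟩
      to τ (to τ (to τ x))                         ≈⟨ τ³ x ⟩
      x                                            ∎
      where
      open SetoidReasoning X
      step : act (to τ x) (w ++ inverse w ++ U ∷ U ∷ []) ≡ to τ (to τ (act (to τ x) (w ++ inverse w)))
      step rewrite act-++ w (inverse w ++ U ∷ U ∷ []) {to τ x}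
                 | act-++ (inverse w) (U ∷ U ∷ []) {act (to τ x) w}
                 | act-++ w (inverse w) {to τ x} = refl

    act-injective : ∀ w {x y} → act x w X.≈ act y w → x X.≈ y
    act-injective w {x} {y} p = begin
      x                           ≈⟨ act-inverse w ⟨
      act x (w ++ inverse w)      ≡⟨ act-++ w (inverse w) ⟩
      act (act x w) (inverse w)   ≈⟨ act-cong (inverse w) p ⟩
      act (act y w) (inverse w)   ≡⟨ act-++ w (inverse w) ⟨
      act y (w ++ inverse w)      ≈⟨ act-inverse w ⟩
      y                           ∎
      where open SetoidReasoning X

    act-cons : ∀ l n {x} → act x ⌊ cons l n ⌋ X.≈ act x (l ∷ ⌊ n ⌋)
    act-cons S (nf false p i)                    = X.refl
    act-cons S (nf true p i)                     = X.sym (act-cong ⌊ nf false p i ⌋ (σ² _))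
    act-cons U (nf true p i)                     = X.refl
    act-cons U (nf false (L ∷ p) i)              = X.refl
    act-cons U (nf false (R ∷ p) i)              = X.sym (act-cong ⌊ nf true p i ⌋ (τ³ _))
    act-cons U (nf false [] zero)                = X.refl
    act-cons U (nf false [] (suc zero))          = X.refl
    act-cons U (nf false [] (suc (suc zero)))    = X.sym (τ³ _)

    act-normalise : ∀ w {x} → act x ⌊ normalise w ⌋ X.≈ act x w
    act-normalise []      = X.refl
    act-normalise (l ∷ w) = X.trans (act-cons l (normalise w)) (act-normalise w)

-- Evaluation of words in Γ

rightMul : Γ → Func Γ-setoid Γ-setoid
rightMul g = record { to = _∙ g ; cong = λ p → ∙-congʳ p }

open WordAction Γ-setoid (rightMul s) (rightMul u) using ()
  renaming (act to mulWord; act-cong to mulWord-cong; act-++ to mulWord-++;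
            act-inverse to mulWord-inverse; act-normalise to mulWord-normalise)

eval : Word → Γ
eval = mulWord ε

s² : s ∙ s ≈ ε
s² = opp refl

u³ : u ∙ u ∙ u ≈ ε
u³ = opp refl

∙s∙s : ∀ g → g ∙ s ∙ s ≈ g
∙s∙s g = ≈-trans (assoc g s s) (≈-trans (∙-congˡ {g} s²) (identityʳ g))

∙u∙u∙u : ∀ g → g ∙ u ∙ u ∙ u ≈ g
∙u∙u∙u g = ≈-trans (∙-congʳ {u} (assoc g u u))
          (≈-trans (assoc g (u ∙ u) u) (≈-trans (∙-congˡ {g} u³) (identityʳ g)))

mulWord-∙ : ∀ w g h → mulWord (g ∙ h) w ≈ g ∙ mulWord h w
mulWord-∙ []      g h = ≈-refl {g ∙ h}
mulWord-∙ (S ∷ w) g h = ≈-trans (mulWord-cong w (assoc g h s)) (mulWord-∙ w g (h ∙ s))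
mulWord-∙ (U ∷ w) g h = ≈-trans (mulWord-cong w (assoc g h u)) (mulWord-∙ w g (h ∙ u))

mulWord-eval : ∀ w g → mulWord g w ≈ g ∙ eval w
mulWord-eval w g = ≈-trans (mulWord-cong w (≈-sym (identityʳ g))) (mulWord-∙ w g ε)

eval-++ : ∀ v w → eval (v ++ w) ≈ eval v ∙ eval w
eval-++ v w = begin
  eval (v ++ w)         ≡⟨ mulWord-++ v w ⟩
  mulWord (eval v) w    ≈⟨ mulWord-eval w (eval v) ⟩
  eval v ∙ eval w       ∎
  where open SetoidReasoning Γ-setoid

eval-inverse : ∀ w → eval (inverse w) ≈ eval w ⁻¹
eval-inverse w = inverseʳ-unique (eval w) (eval (inverse w))
  (≈-trans (≈-sym (eval-++ w (inverse w))) (mulWord-inverse ∙s∙s ∙u∙u∙u w))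

-- Ping-pong: normal forms are faithful

-- The shape of the products of us = ( 1 0 ; 1 1 ) and u²s = ( 1 1 ; 0 1 ).
record NonNegative (n : ℕ) (M : Mat₂) : Set where
  constructor nonNeg
  field
    {a b c d} : ℕ
    shape     : M ≡ mat +[1+ a ] (+ b) (+ c) +[1+ d ]
    bound     : n ≤ b ℕ.+ c

us-shape : ∀ M → M · matrix u · matrix s ≡
           mat (Mat₂.a M + Mat₂.b M) (Mat₂.b M) (Mat₂.c M + Mat₂.d M) (Mat₂.d M)
us-shape (mat a b c d) = mat-cong (eq₁ a b) (eq₂ a b) (eq₁ c d) (eq₂ c d)
  where
  eq₁ : ∀ x y → (x * 0ℤ + y * -1ℤ) * 0ℤ + (x * 1ℤ + y * 1ℤ) * 1ℤ ≡ x + y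
  eq₁ = solve-∀
  eq₂ : ∀ x y → (x * 0ℤ + y * -1ℤ) * -1ℤ + (x * 1ℤ + y * 1ℤ) * 0ℤ ≡ y
  eq₂ = solve-∀

uus-shape : ∀ M → M · matrix u · matrix u · matrix s ≡
            mat (Mat₂.a M) (Mat₂.a M + Mat₂.b M) (Mat₂.c M) (Mat₂.c M + Mat₂.d M)
uus-shape (mat a b c d) = mat-cong (eq₁ a b) (eq₂ a b) (eq₁ c d) (eq₂ c d)
  where
  eq₁ : ∀ x y → ((x * 0ℤ + y * -1ℤ) * 0ℤ + (x * 1ℤ + y * 1ℤ) * -1ℤ) * 0ℤ
              + ((x * 0ℤ + y * -1ℤ) * 1ℤ + (x * 1ℤ + y * 1ℤ) * 1ℤ) * 1ℤ ≡ x
  eq₁ = solve-∀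
  eq₂ : ∀ x y → ((x * 0ℤ + y * -1ℤ) * 0ℤ + (x * 1ℤ + y * 1ℤ) * -1ℤ) * -1ℤ
              + ((x * 0ℤ + y * -1ℤ) * 1ℤ + (x * 1ℤ + y * 1ℤ) * 1ℤ) * 0ℤ ≡ x + y
  eq₂ = solve-∀

-- Each syllable adds a positive diagonal entry to an off-diagonal one, `L` the lower right to c and
-- `R` the upper left to b. The off-diagonal sum thus grows by at least one per syllable.
mulWord-nonNegative : ∀ p {n g} → NonNegative n (matrix g) →
                      NonNegative (length p ℕ.+ n) (matrix (mulWord g (spell p)))
mulWord-nonNegative []      h = h
mulWord-nonNegative (L ∷ p) {n} {g} (nonNeg {a} {b} {c} {d} refl q) =
  ≡.subst (λ k → NonNegative k (matrix (mulWord (g ∙ u ∙ s) (spell p)))) (ℕ.+-suc (length p) n)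
    (mulWord-nonNegative p (nonNeg (us-shape (matrix g)) (begin
      suc n                    ≤⟨ s≤s q ⟩
      suc (b ℕ.+ c)            ≤⟨ s≤s (ℕ.m≤m+n (b ℕ.+ c) d) ⟩
      suc (b ℕ.+ c ℕ.+ d)      ≡⟨ cong suc (ℕ.+-assoc b c d) ⟩
      suc (b ℕ.+ (c ℕ.+ d))    ≡⟨ ℕ.+-suc b (c ℕ.+ d) ⟨
      b ℕ.+ suc (c ℕ.+ d)      ≡⟨ cong (b ℕ.+_) (ℕ.+-suc c d) ⟨
      b ℕ.+ (c ℕ.+ suc d)      ∎)))
  where open ℕ.≤-Reasoning
mulWord-nonNegative (R ∷ p) {n} {g} (nonNeg {a} {b} {c} {d} refl q) =
  ≡.subst (λ k → NonNegative k (matrix (mulWord (g ∙ u ∙ u ∙ s) (spell p)))) (ℕ.+-suc (length p) n)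
    (mulWord-nonNegative p (nonNeg (≡.trans (uus-shape (matrix g))
                                      (mat-cong refl refl refl (cong +_ (ℕ.+-suc c d))))
      (s≤s (ℕ.≤-trans q (ℕ.+-monoˡ-≤ c (ℕ.m≤n+m b a))))))

≈ε⇒offDiagonal≡0 : ∀ {g} → g ≈ ε → Mat₂.b (matrix g) ≡ 0ℤ × Mat₂.c (matrix g) ≡ 0ℤ
≈ε⇒offDiagonal≡0 (same p) = cong Mat₂.b p , cong Mat₂.c p
≈ε⇒offDiagonal≡0 (opp p)  = cong Mat₂.b p , cong Mat₂.c p

eval-⌊true⌋ : ∀ p i → eval ⌊ nf true p i ⌋ ≈ s ∙ eval ⌊ nf false p i ⌋
eval-⌊true⌋ p i = ≈-trans (mulWord-cong ⌊ nf false p i ⌋ (identityˡ s)) (mulWord-eval ⌊ nf false p i ⌋ s)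

eval-⌊false⌋ : ∀ p i → eval ⌊ nf false p i ⌋ ≡ mulWord (eval (spell p)) (replicate (toℕ i) U)
eval-⌊false⌋ p i = mulWord-++ (spell p) (replicate (toℕ i) U)

-- In every case but the empty word, an off-diagonal entry does not vanish.
eval-⌊⌋-faithful : ∀ n → eval ⌊ n ⌋ ≈ ε → n ≡ nf false [] zero
eval-⌊⌋-faithful (nf false p i) q rewrite eval-⌊false⌋ p i
  with eval (spell p) | mulWord-nonNegative p {0} {ε} (nonNeg refl z≤n)
... | g | nonNeg {a} {b} {c} {d} refl l = go p i l q
  where
  eq₁ : ∀ x y → x * 0ℤ + y * -1ℤ ≡ - y
  eq₁ = solve-∀
  eq₂ : ∀ x y → (x * 0ℤ + y * -1ℤ) * 1ℤ + (x * 1ℤ + y * 1ℤ) * 1ℤ ≡ x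
  eq₂ = solve-∀
  go : ∀ p i → length p ℕ.+ 0 ≤ b ℕ.+ c → mulWord g (replicate (toℕ i) U) ≈ ε →
       nf false p i ≡ nf false [] zero
  go p (suc zero) _ q with () ← ≡.trans (≡.sym (eq₁ (+ c) +[1+ d ])) (proj₂ (≈ε⇒offDiagonal≡0 q))
  go p (suc (suc zero)) _ q with () ← ≡.trans (≡.sym (eq₂ +[1+ a ] (+ b))) (proj₁ (≈ε⇒offDiagonal≡0 q))
  -- With no trailing u, both off-diagonal entries of the product itself vanish, and the bound on
  -- their sum forces `p` to be empty.
  go p zero l q with refl ← proj₁ (≈ε⇒offDiagonal≡0 q) | refl ← proj₂ (≈ε⇒offDiagonal≡0 q) = only-empty p l
    where
    only-empty : ∀ p → length p ℕ.+ 0 ≤ 0 → nf false p zero ≡ nf false [] zero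
    only-empty [] _ = refl
eval-⌊⌋-faithful (nf true p i) q with ≈-trans (≈-sym (eval-⌊true⌋ p i)) q
... | q′ rewrite eval-⌊false⌋ p i
  with eval (spell p) | mulWord-nonNegative p {0} {ε} (nonNeg refl z≤n)
... | g | nonNeg {a} {b} {c} {d} refl _ = ⊥-elim (go i q′)
  where
  eq₁ : ∀ x y → 1ℤ * x + 0ℤ * y ≡ x
  eq₁ = solve-∀
  eq₂ : ∀ x y z t → 0ℤ * (x * 1ℤ + y * 1ℤ) + -1ℤ * (z * 1ℤ + t * 1ℤ) ≡ - (z + t)
  eq₂ = solve-∀
  eq₃ : ∀ x y z t → 1ℤ * ((x * 0ℤ + y * -1ℤ) * 0ℤ + (x * 1ℤ + y * 1ℤ) * -1ℤ)
                  + 0ℤ * ((z * 0ℤ + t * -1ℤ) * 0ℤ + (z * 1ℤ + t * 1ℤ) * -1ℤ) ≡ - (x + y)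
  eq₃ = solve-∀
  go : ∀ i → ¬ (s ∙ mulWord g (replicate (toℕ i) U) ≈ ε)
  go zero q
    with () ← ≡.trans (≡.sym (eq₁ +[1+ a ] (+ c))) (proj₂ (≈ε⇒offDiagonal≡0 q))
  go (suc zero) q
    with () ← ≡.trans (≡.sym (≡.trans (eq₂ +[1+ a ] (+ b) (+ c) +[1+ d ])
                (cong (λ n → - (+ n)) (ℕ.+-suc c d))))
              (proj₁ (≈ε⇒offDiagonal≡0 q))
  go (suc (suc zero)) q
    with () ← ≡.trans (≡.sym (eq₃ +[1+ a ] (+ b) (+ c) +[1+ d ])) (proj₂ (≈ε⇒offDiagonal≡0 q))

-- Generation of Γ by s and u

module _ (H : Subgroup) (s∈H : s ∈ member H) (u∈H : u ∈ member H) where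

  private
    -- The equality of Γ ignores the proof that the determinant is 1. Quantifying over that proof
    -- lets matrices be rewritten entry by entry without transporting it.
    Belongs : Mat₂ → Set
    Belongs M = ∀ δ → sl M δ ∈ member H

    belongs : ∀ {g} → g ∈ member H → Belongs (matrix g)
    belongs g∈H δ = resp H (same refl) g∈H

    belongs-≡ : ∀ {M N} → M ≡ N → Belongs M → Belongs N
    belongs-≡ refl h = h

    belongs-negation : ∀ {g} → Belongs (-ᴹ matrix g) → g ∈ member H
    belongs-negation {sl (mat a b c d) δ} h =
      resp H {sl (mat (- a) (- b) (- c) (- d)) δ′} (opp refl) (h δ′)
      where
      eq : ∀ a b c d → - a * - d - - b * - c ≡ a * d - b * c
      eq = solve-∀
      δ′ : - a * - d - - b * - c ≡ 1ℤ
      δ′ = ≡.trans (eq a b c d) δ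

    cancelˡ : ∀ {g} h → g ∈ member H → Belongs (matrix (g ∙ h)) → h ∈ member H
    cancelˡ {g} h g∈H p = resp H (≈-trans (≈-sym (assoc (g ⁻¹) g h))
        (≈-trans (∙-congʳ {h} (inverseˡ g)) (identityˡ h)))
      (∙-closed H (⁻¹-closed H g∈H) (p (det≡1 (g ∙ h))))

    us∈H : u ∙ s ∈ member H
    us∈H = ∙-closed H u∈H s∈H

    uus∈H : u ∙ u ∙ s ∈ member H
    uus∈H = ∙-closed H (∙-closed H u∈H u∈H) s∈H

    upper⁺ : ∀ n → Belongs (mat 1ℤ (+ n) 0ℤ 1ℤ)
    upper⁺ zero    = belongs (ε-closed H)
    upper⁺ (suc n) δ = cancelˡ (sl (mat 1ℤ +[1+ n ] 0ℤ 1ℤ) δ) (⁻¹-closed H uus∈H)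
      (belongs-≡ (mat-cong refl (≡.sym (eq (+ n))) refl refl) (upper⁺ n))
      where
      eq : ∀ x → 1ℤ * (1ℤ + x) + -1ℤ * 1ℤ ≡ x
      eq = solve-∀

    upper : ∀ x → Belongs (mat 1ℤ x 0ℤ 1ℤ)
    upper (+ n)    = upper⁺ n
    upper -[1+ n ] =
      belongs (⁻¹-closed H (upper⁺ (suc n) (cong (λ y → 1ℤ - y) (ℤ.*-zeroʳ +[1+ n ]))))

    -- Left multiplication by the inverse of us subtracts the first row from the second, by the
    -- inverse of u²s the second from the first; n bounds the number of rounds. Once an entry of the
    -- column vanishes, determinant 1 leaves an upper unitriangular matrix, up to a factor s.
    euclid : ∀ n a c b d → a ℕ.+ c ≤ n → Belongs (mat (+ a) b (+ c) d)
    euclid n zero c b d _ δ = cancelˡ (sl (mat 0ℤ b (+ c) d) δ) (⁻¹-closed H s∈H)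
      (belongs-≡ (mat-cong (≡.sym (≡.trans (eq₁ (+ c)) c≡1)) (≡.sym (eq₁′ b d)) refl
                           (≡.sym (≡.trans (eq₂ b d) -b≡1))) (upper d))
      where
      eq₁ : ∀ c → 0ℤ * 0ℤ + 1ℤ * c ≡ c
      eq₁ = solve-∀
      eq₁′ : ∀ b d → 0ℤ * b + 1ℤ * d ≡ d
      eq₁′ = solve-∀
      eq₂ : ∀ b d → -1ℤ * b + 0ℤ * d ≡ - b
      eq₂ = solve-∀
      eq₃ : ∀ b c d → - b * c ≡ 0ℤ * d - b * c
      eq₃ = solve-∀
      -b*c≡1 : - b * + c ≡ 1ℤ
      -b*c≡1 = ≡.trans (eq₃ b (+ c) d) δ
      c≡1 : + c ≡ 1ℤ
      c≡1 = cong +_ (ℕ.m*n≡1⇒n≡1 ∣ - b ∣ c (≡.trans (≡.sym (ℤ.abs-* (- b) (+ c))) (cong ∣_∣ -b*c≡1)))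
      -b≡1 : - b ≡ 1ℤ
      -b≡1 = ≡.trans (≡.sym (ℤ.*-identityʳ (- b))) (≡.trans (cong (- b *_) (≡.sym c≡1)) -b*c≡1)
    euclid n (suc a) zero b d _ δ =
      belongs-≡ (mat-cong (≡.sym a≡1) refl refl (≡.sym d≡1)) (upper b) δ
      where
      eq : ∀ a b d → a * d ≡ a * d - b * 0ℤ
      eq = solve-∀
      a*d≡1 : +[1+ a ] * d ≡ 1ℤ
      a*d≡1 = ≡.trans (eq +[1+ a ] b d) δ
      a≡1 : +[1+ a ] ≡ 1ℤ
      a≡1 = cong +_ (ℕ.m*n≡1⇒m≡1 (suc a) ∣ d ∣ (≡.trans (≡.sym (ℤ.abs-* +[1+ a ] d)) (cong ∣_∣ a*d≡1)))
      d≡1 : d ≡ 1ℤ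
      d≡1 = ≡.trans (≡.sym (ℤ.*-identityˡ d)) (≡.trans (cong (_* d) (≡.sym a≡1)) a*d≡1)
    euclid (suc n) (suc a) (suc c) b d (s≤s l) δ with ℕ.≤-total a c
    ... | inj₁ a≤c with k , refl ← ℕ.m≤n⇒∃[o]m+o≡n a≤c =
      cancelˡ (sl (mat +[1+ a ] b +[1+ a ℕ.+ k ] d) δ) (⁻¹-closed H us∈H)
        (belongs-≡ (mat-cong (≡.sym (eq₁ +[1+ a ] +[1+ a ℕ.+ k ])) (≡.sym (eq₁ b d))
                             (≡.sym (eq₂ +[1+ a ] (+ k))) refl)
          (euclid n (suc a) k b _ (ℕ.≤-trans (ℕ.≤-trans (ℕ.≤-reflexive (≡.sym (ℕ.+-suc a k))) (ℕ.+-monoʳ-≤ a (s≤s (ℕ.m≤n+m k a)))) l)))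
      where
      eq₁ : ∀ x y → 1ℤ * x + 0ℤ * y ≡ x
      eq₁ = solve-∀
      eq₂ : ∀ x y → -1ℤ * x + 1ℤ * (x + y) ≡ y
      eq₂ = solve-∀
    ... | inj₂ c≤a with k , refl ← ℕ.m≤n⇒∃[o]m+o≡n c≤a =
      cancelˡ (sl (mat +[1+ c ℕ.+ k ] b +[1+ c ] d) δ) (⁻¹-closed H uus∈H)
        (belongs-≡ (mat-cong (≡.sym (eq₂ +[1+ c ] (+ k))) refl
                             (≡.sym (eq₁ +[1+ c ℕ.+ k ] +[1+ c ])) (≡.sym (eq₁ b d)))
          (euclid n k (suc c) _ d (ℕ.≤-trans (ℕ.+-monoˡ-≤ (suc c) (ℕ.m≤n+m k c)) l)))
      where
      eq₁ : ∀ x y → 0ℤ * x + 1ℤ * y ≡ y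
      eq₁ = solve-∀
      eq₂ : ∀ x y → 1ℤ * (x + y) + -1ℤ * x ≡ y
      eq₂ = solve-∀

  -- A first column with two negative entries is negated, one with a single negative entry is
  -- rotated by s or its inverse, and then `euclid` applies. The result serves as an induction
  -- principle on Γ: a property stable under products and inverses is packaged as a subgroup and
  -- checked on s and u.
  generated : ∀ g → g ∈ member H
  generated (sl (mat (+ a) b (+ c) d) δ) = euclid _ a c b d ℕ.≤-refl δ
  generated g@(sl (mat (-[1+ a ]) b (-[1+ c ]) d) δ) =
    belongs-negation {g} (euclid _ (suc a) (suc c) (- b) (- d) ℕ.≤-refl)
  generated g@(sl (mat (+ a) b (-[1+ c ]) d) δ) =
    cancelˡ g s∈H (belongs-≡ (mat-cong (eq₁ (+ a) -[1+ c ]) refl (eq₂ (+ a) -[1+ c ]) refl)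
      (euclid _ (suc c) a _ _ ℕ.≤-refl))
    where
    eq₁ : ∀ x y → - y ≡ 0ℤ * x + -1ℤ * y
    eq₁ = solve-∀
    eq₂ : ∀ x y → x ≡ 1ℤ * x + 0ℤ * y
    eq₂ = solve-∀
  generated g@(sl (mat (-[1+ a ]) b (+ c) d) δ) =
    cancelˡ g (⁻¹-closed H s∈H) (belongs-≡ (mat-cong (eq₁ -[1+ a ] (+ c)) refl (eq₂ -[1+ a ] (+ c)) refl)
      (euclid _ c (suc a) _ _ ℕ.≤-refl))
    where
    eq₁ : ∀ x y → y ≡ 0ℤ * x + 1ℤ * y
    eq₁ = solve-∀
    eq₂ : ∀ x y → - x ≡ -1ℤ * x + 0ℤ * y
    eq₂ = solve-∀

words : Subgroup
words = record
  { member    = λ g → ∃ λ w → eval w ≈ g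
  ; resp      = λ p (w , q) → w , ≈-trans q p
  ; ε-closed  = [] , ≈-refl {ε}
  ; ∙-closed  = λ (v , p) (w , q) → v ++ w , ≈-trans (eval-++ v w) (∙-cong p q)
  ; ⁻¹-closed = λ (w , p) → inverse w , ≈-trans (eval-inverse w) (⁻¹-cong p)
  }

word : ∀ g → ∃ λ w → eval w ≈ g
word = generated words (S ∷ [] , identityˡ s) (U ∷ [] , identityˡ u)

-- Right actions of Γ and stabilisers

record RightAction (X : Setoid 0ℓ 0ℓ) : Set where
  private module X = Setoid X
  infixl 7 _◃_
  field
    _◃_        : X.Carrier → Γ → X.Carrier
    ◃-cong     : ∀ {x y g h} → x X.≈ y → g ≈ h → x ◃ g X.≈ y ◃ h
    ◃-identity : ∀ x → x ◃ ε X.≈ x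
    ◃-assoc    : ∀ x g h → x ◃ (g ∙ h) X.≈ x ◃ g ◃ h

  ◃-congˡ : ∀ {x g h} → g ≈ h → x ◃ g X.≈ x ◃ h
  ◃-congˡ = ◃-cong X.refl

  ◃-congʳ : ∀ {x y} g → x X.≈ y → x ◃ g X.≈ y ◃ g
  ◃-congʳ g x≈y = ◃-cong x≈y (≈-refl {g})

  ◃-cancel : ∀ x g → x ◃ g ◃ g ⁻¹ X.≈ x
  ◃-cancel x g = X.trans (X.sym (◃-assoc x g (g ⁻¹)))
                (X.trans (◃-congˡ (inverseʳ g)) (◃-identity x))

  ◃-cancel⁻¹ : ∀ x g → x ◃ g ⁻¹ ◃ g X.≈ x
  ◃-cancel⁻¹ x g = X.trans (X.sym (◃-assoc x (g ⁻¹) g))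
                  (X.trans (◃-congˡ (inverseˡ g)) (◃-identity x))

  ◃-transpose : ∀ {x y} g → x ◃ g X.≈ y → y ◃ g ⁻¹ X.≈ x
  ◃-transpose g p = X.trans (◃-congʳ (g ⁻¹) (X.sym p)) (◃-cancel _ g)

  stabiliser : X.Carrier → Subgroup
  stabiliser x = record
    { member    = λ g → x ◃ g X.≈ x
    ; resp      = λ p q → X.trans (◃-congˡ (≈-sym p)) q
    ; ε-closed  = ◃-identity x
    ; ∙-closed  = λ {g} {h} p q → X.trans (◃-assoc x g h) (X.trans (◃-congʳ h p) q)
    ; ⁻¹-closed = λ {g} p → ◃-transpose g p
    }

  agree⇒stabiliser : ∀ {x} g h → x ◃ g X.≈ x ◃ h → g ∙ h ⁻¹ ∈ member (stabiliser x)
  agree⇒stabiliser g h p = X.trans (◃-assoc _ g (h ⁻¹)) (◃-transpose h (X.sym p))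

  stabiliser⇒agree : ∀ {x} g h → g ∙ h ⁻¹ ∈ member (stabiliser x) → x ◃ g X.≈ x ◃ h
  stabiliser⇒agree {x} g h p = begin
    x ◃ g                 ≈⟨ ◃-cancel⁻¹ (x ◃ g) h ⟨
    x ◃ g ◃ h ⁻¹ ◃ h      ≈⟨ ◃-congʳ h (◃-assoc x g (h ⁻¹)) ⟨
    x ◃ (g ∙ h ⁻¹) ◃ h    ≈⟨ ◃-congʳ h p ⟩
    x ◃ h                 ∎
    where open SetoidReasoning X

  IsTransitive : Set
  IsTransitive = ∀ x y → ∃ λ g → x ◃ g X.≈ y

-- The action of Γ defined by two permutations

module FreeProduct (X : Setoid 0ℓ 0ℓ) (σ τ : Func X X)
  (σ² : ∀ x → Setoid._≈_ X (Func.to σ (Func.to σ x)) x)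
  (τ³ : ∀ x → Setoid._≈_ X (Func.to τ (Func.to τ (Func.to τ x))) x) where

  private module X = Setoid X
  open WordAction X σ τ
  open SetoidReasoning X

  act-trivial : ∀ w x → eval w ≈ ε → act x w X.≈ x
  act-trivial w x p = begin
    act x w                   ≈⟨ act-normalise σ² τ³ w ⟨
    act x ⌊ normalise w ⌋     ≡⟨ cong (λ n → act x ⌊ n ⌋) (eval-⌊⌋-faithful (normalise w)
                                   (≈-trans (mulWord-normalise ∙s∙s ∙u∙u∙u w) p)) ⟩
    x                         ∎

  -- Acting by `inverse w` is injective, so the two sides may be compared after it; there both words
  -- have value 1 and act trivially.
  act-respects : ∀ v w x → eval v ≈ eval w → act x v X.≈ act x w
  act-respects v w x p = act-injective σ² τ³ (inverse w) (begin
    act (act x v) (inverse w)   ≡⟨ act-++ v (inverse w) ⟨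
    act x (v ++ inverse w)      ≈⟨ act-trivial (v ++ inverse w) x v/w ⟩
    x                           ≈⟨ act-inverse σ² τ³ w ⟨
    act x (w ++ inverse w)      ≡⟨ act-++ w (inverse w) ⟩
    act (act x w) (inverse w)   ∎)
    where
    v/w : eval (v ++ inverse w) ≈ ε
    v/w = ≈-trans (eval-++ v (inverse w)) (≈-trans (∙-cong p (eval-inverse w)) (inverseʳ (eval w)))

  act-word : ∀ {g} w x → eval w ≈ g → act x (proj₁ (word g)) X.≈ act x w
  act-word {g} w x p = act-respects (proj₁ (word g)) w x (≈-trans (proj₂ (word g)) (≈-sym p))

  abstract
    -- An element acts through its chosen word. Being abstract, the choice stays hidden: what
    -- follows sees the laws of an action and its values at s and u.
    action : RightAction X
    action = record
      { _◃_        = λ x g → act x (proj₁ (word g))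
      ; ◃-cong     = λ {x} {y} {g} {h} x≈y g≈h → X.trans (act-cong (proj₁ (word g)) x≈y)
                       (X.sym (act-word (proj₁ (word g)) y (≈-trans (proj₂ (word g)) g≈h)))
      ; ◃-identity = λ x → act-word [] x (≈-refl {ε})
      ; ◃-assoc    = λ x g h → X.trans
          (act-word (proj₁ (word g) ++ proj₁ (word h)) x
            (≈-trans (eval-++ (proj₁ (word g)) (proj₁ (word h))) (∙-cong (proj₂ (word g)) (proj₂ (word h)))))
          (X.reflexive (act-++ (proj₁ (word g)) (proj₁ (word h))))
      }

    ◃-s : ∀ x → RightAction._◃_ action x s X.≈ Func.to σ x
    ◃-s x = act-word (S ∷ []) x (identityˡ s)

    ◃-u : ∀ x → RightAction._◃_ action x u X.≈ Func.to τ x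
    ◃-u x = act-word (U ∷ []) x (identityˡ u)

-- Vertices as orbits of the cyclic subgroups

⟨⟩-least : ∀ (H : Subgroup) {g k} → g ∈ member H → k ∈ member ⟨ g ⟩ → k ∈ member H
⟨⟩-least H g∈H gen       = g∈H
⟨⟩-least H g∈H (rep p k) = resp H p (⟨⟩-least H g∈H k)
⟨⟩-least H g∈H unit      = ε-closed H
⟨⟩-least H g∈H (mul k l) = ∙-closed H (⟨⟩-least H g∈H k) (⟨⟩-least H g∈H l)
⟨⟩-least H g∈H (inv k)   = ⁻¹-closed H (⟨⟩-least H g∈H k)

G₀-elements : ∀ {k} → k ∈ member G₀ → k ≈ ε ⊎ k ≈ s
G₀-elements gen       = inj₂ (≈-refl {s})
G₀-elements (rep p k) = Sum.map (≈-trans (≈-sym p)) (≈-trans (≈-sym p)) (G₀-elements k)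
G₀-elements unit      = inj₁ (≈-refl {ε})
G₀-elements (mul k l) with G₀-elements k | G₀-elements l
... | inj₁ p | inj₁ q = inj₁ (≈-trans (∙-cong p q) (same refl))
... | inj₁ p | inj₂ q = inj₂ (≈-trans (∙-cong p q) (same refl))
... | inj₂ p | inj₁ q = inj₂ (≈-trans (∙-cong p q) (same refl))
... | inj₂ p | inj₂ q = inj₁ (≈-trans (∙-cong p q) (opp refl))
G₀-elements (inv k) with G₀-elements k
... | inj₁ p = inj₁ (≈-trans (⁻¹-cong p) (same refl))
... | inj₂ p = inj₂ (≈-trans (⁻¹-cong p) (opp refl))

G₁-elements : ∀ {k} → k ∈ member G₁ → k ≈ ε ⊎ k ≈ u ⊎ k ≈ u ∙ u
G₁-elements gen       = inj₂ (inj₁ (≈-refl {u}))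
G₁-elements (rep p k) = Sum.map (≈-trans (≈-sym p))
                          (Sum.map (≈-trans (≈-sym p)) (≈-trans (≈-sym p))) (G₁-elements k)
G₁-elements unit      = inj₁ (≈-refl {ε})
G₁-elements (mul k l) with G₁-elements k | G₁-elements l
... | inj₁ p        | inj₁ q        = inj₁ (≈-trans (∙-cong p q) (same refl))
... | inj₁ p        | inj₂ (inj₁ q) = inj₂ (inj₁ (≈-trans (∙-cong p q) (same refl)))
... | inj₁ p        | inj₂ (inj₂ q) = inj₂ (inj₂ (≈-trans (∙-cong p q) (same refl)))
... | inj₂ (inj₁ p) | inj₁ q        = inj₂ (inj₁ (≈-trans (∙-cong p q) (same refl)))
... | inj₂ (inj₁ p) | inj₂ (inj₁ q) = inj₂ (inj₂ (≈-trans (∙-cong p q) (same refl)))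
... | inj₂ (inj₁ p) | inj₂ (inj₂ q) = inj₁ (≈-trans (∙-cong p q) (opp refl))
... | inj₂ (inj₂ p) | inj₁ q        = inj₂ (inj₂ (≈-trans (∙-cong p q) (same refl)))
... | inj₂ (inj₂ p) | inj₂ (inj₁ q) = inj₁ (≈-trans (∙-cong p q) (opp refl))
... | inj₂ (inj₂ p) | inj₂ (inj₂ q) = inj₂ (inj₁ (≈-trans (∙-cong p q) (opp refl)))
G₁-elements (inv k) with G₁-elements k
... | inj₁ p        = inj₁ (≈-trans (⁻¹-cong p) (same refl))
... | inj₂ (inj₁ p) = inj₂ (inj₂ (≈-trans (⁻¹-cong p) (opp refl)))
... | inj₂ (inj₂ p) = inj₂ (inj₁ (≈-trans (⁻¹-cong p) (opp refl)))

-- The vertices of an abstract graph form a setoid of their own; these fields identify it, through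
-- `end`, with the set of `K`-orbits of edges. `surjective` also provides a chosen edge at each
-- vertex, from which maps of vertices are built.
record IsQuotient {E V : Setoid 0ℓ 0ℓ} (action : RightAction E) (K : Subgroup) (end : Func E V) : Set where
  open RightAction action
  open Func end
  private
    module E = Setoid E
    module V = Setoid V
  field
    surjective : ∀ v → ∃ λ e → to e V.≈ v
    fibre      : ∀ {e e′} → to e V.≈ to e′ → ∃ λ k → k ∈ member K × e ◃ k E.≈ e′
    invariant  : ∀ e {k} → k ∈ member K → to (e ◃ k) V.≈ to e

  section : V.Carrier → E.Carrier
  section v = proj₁ (surjective v)

  to-section : ∀ v → to (section v) V.≈ v
  to-section v = proj₂ (surjective v)

Equivariant : ∀ {E E′ : Setoid 0ℓ 0ℓ} → RightAction E → RightAction E′ →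
              (Setoid.Carrier E → Setoid.Carrier E′) → Set
Equivariant {E} {E′} A A′ f = ∀ e g → f (e A.◃ g) E′.≈ f e A′.◃ g
  where
  module E′ = Setoid E′
  module A  = RightAction A
  module A′ = RightAction A′

module _ {E V E′ V′ : Setoid 0ℓ 0ℓ} {A : RightAction E} {A′ : RightAction E′}
         {end : Func E V} {end′ : Func E′ V′} {K : Subgroup}
         (Q : IsQuotient A K end) (Q′ : IsQuotient A′ K end′) where

  private
    module V  = Setoid V
    module V′ = Setoid V′
    module E′ = Setoid E′
    module A′ = RightAction A′
    module Q  = IsQuotient Q
    module Q′ = IsQuotient Q′
    module end  = Func end
    module end′ = Func end′

  sameEnd-map : ∀ {f} → (∀ {e e′} → Setoid._≈_ E e e′ → f e E′.≈ f e′) → Equivariant A A′ f →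
                ∀ {e e′} → end.to e V.≈ end.to e′ → end′.to (f e) V′.≈ end′.to (f e′)
  sameEnd-map f-cong equiv {e} p with k , k∈K , q ← Q.fibre p =
    V′.trans (V′.sym (Q′.invariant _ k∈K))
             (end′.cong (E′.trans (E′.sym (equiv e k)) (f-cong q)))

  -- When g fixes e, the edge e is alone at its vertex, hence so is φ e.
  map-fixed : ∀ {g} (φ : Inverse E E′) → (∀ {k} → k ∈ member K → k ∈ member ⟨ g ⟩) → g ∈ member K →
              (∀ {e e′} → end′.to (Inverse.to φ e) V′.≈ end′.to (Inverse.to φ e′) → end.to e V.≈ end.to e′) →
              ∀ {e} → Setoid._≈_ E (RightAction._◃_ A e g) e →
              Inverse.to φ (RightAction._◃_ A e g) E′.≈ Inverse.to φ e A′.◃ g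
  map-fixed {g} φ K⊆ g∈K reflect {e} fixed = begin
    to (e A.◃ g)     ≈⟨ to-cong fixed ⟩
    to e             ≈⟨ to-cong (⟨⟩-least (A.stabiliser e) fixed (K⊆ k∈K)) ⟨
    to (e A.◃ k)     ≈⟨ Inverse.inverseˡ φ q ⟩
    to e A′.◃ g      ∎
    where
    open SetoidReasoning E′
    open Inverse φ using (to; from; to-cong; strictlyInverseˡ)
    module A = RightAction A
    alone : ∃ λ k → k ∈ member K × Setoid._≈_ E (e A.◃ k) (from (to e A′.◃ g))
    alone = Q.fibre (reflect (V′.sym (V′.trans (end′.cong (strictlyInverseˡ _)) (Q′.invariant (to e) g∈K))))
    k   = proj₁ alone
    k∈K = proj₁ (proj₂ alone)
    q   = proj₂ (proj₂ alone)

module _ {E V E′ V′ : Setoid 0ℓ 0ℓ} {A : RightAction E} {A′ : RightAction E′}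
         {end : Func E V} {end′ : Func E′ V′} {K : Subgroup}
         (Q : IsQuotient A K end) (Q′ : IsQuotient A′ K end′)
         (φ : Inverse E E′) (equiv : Equivariant A A′ (Inverse.to φ)) where

  private
    module E′ = Setoid E′
    module V  = Setoid V
    module V′ = Setoid V′
    module A′ = RightAction A′
    module Q  = IsQuotient Q
    module Q′ = IsQuotient Q′
    module end  = Func end
    module end′ = Func end′
    module φ = Inverse φ

    equiv⁻¹ : Equivariant A′ A φ.from
    equiv⁻¹ e g = φ.inverseʳ (E′.trans (A′.◃-congʳ g (E′.sym (φ.strictlyInverseˡ e)))
                                       (E′.sym (equiv (φ.from e) g)))

    there : ∀ {e e′} → end.to e V.≈ end.to e′ → end′.to (φ.to e) V′.≈ end′.to (φ.to e′)
    there = sameEnd-map Q Q′ φ.to-cong equiv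

    back : ∀ {e e′} → end′.to e V′.≈ end′.to e′ → end.to (φ.from e) V.≈ end.to (φ.from e′)
    back = sameEnd-map Q′ Q φ.from-cong equiv⁻¹

    to : V.Carrier → V′.Carrier
    to v = end′.to (φ.to (Q.section v))

    from : V′.Carrier → V.Carrier
    from v = end.to (φ.from (Q′.section v))

    to-cong : ∀ {v w} → v V.≈ w → to v V′.≈ to w
    to-cong {v} {w} p = there (V.trans (Q.to-section v) (V.trans p (V.sym (Q.to-section w))))

    from-cong : ∀ {v w} → v V′.≈ w → from v V.≈ from w
    from-cong {v} {w} p = back (V′.trans (Q′.to-section v) (V′.trans p (V′.sym (Q′.to-section w))))

  descend-comm : ∀ e → end′.to (φ.to e) V′.≈ to (end.to e)
  descend-comm e = V′.sym (there (Q.to-section (end.to e)))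

  private
    to-from : ∀ v → to (from v) V′.≈ v
    to-from v = V′.trans (V′.sym (descend-comm _))
               (V′.trans (end′.cong (φ.strictlyInverseˡ _)) (Q′.to-section v))

    from-to : ∀ v → from (to v) V.≈ v
    from-to v = V.trans (back (Q′.to-section (to v)))
               (V.trans (end.cong (φ.strictlyInverseʳ _)) (Q.to-section v))

  -- A vertex goes to the end of the image of its chosen edge. Equivariance makes the class of that
  -- end independent of the choice, and the inverse is built in the same way from the chosen edges
  -- of the target.
  descend : Inverse V V′
  descend = record
    { to        = to
    ; from      = from
    ; to-cong   = to-cong
    ; from-cong = from-cong
    ; inverse   = (λ p → V′.trans (to-cong p) (to-from _))
                , (λ p → V.trans (from-cong p) (from-to _))
    }

-- Graphs with monodromy and their isomorphisms

-- The common ground of `Ycomb G` and an arbitrary cuboid graph, so that isomorphisms between the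
-- two kinds are handled once. `cyclic` is confined to trivalent vertices because `Cyclic` is
-- arbitrary elsewhere.
record Monodromy (Y : BipartiteGraph) : Set where
  open BipartiteGraph Y
  private module E = Setoid Edge
  field
    action : RightAction Edge
  open RightAction action public
  field
    transitive : IsTransitive
    quotient₀  : IsQuotient action G₀ end₀
    quotient₁  : IsQuotient action G₁ end₁
    cyclic     : ∀ v → HasValency₁ v 3 → ∀ ((a , _) (b , _) (c , _) : Setoid.Carrier (Star₁ v)) →
                 Cyclic a b c ⇔ (b E.≈ a ◃ u × c E.≈ a ◃ (u ∙ u))

valency-one : ∀ {A : Setoid 0ℓ 0ℓ} → Inverse (≡.setoid (Fin 1)) A → ∀ x y → Setoid._≈_ A x y
valency-one {A} I x y = Setoid.trans A (Setoid.sym A (strictlyInverseˡ x))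
  (Setoid.trans A (to-cong (fin-one (from x) (from y))) (strictlyInverseˡ y))
  where
  open Inverse I using (to-cong; from; strictlyInverseˡ)
  fin-one : (i j : Fin 1) → i ≡ j
  fin-one zero zero = refl

module _ {Y Z : BipartiteGraph} (MY : Monodromy Y) (MZ : Monodromy Z) where
  private
    module Y = BipartiteGraph Y
    module Z = BipartiteGraph Z
    module E  = Setoid Y.Edge
    module E′ = Setoid Z.Edge
    module MY = Monodromy MY
    module MZ = Monodromy MZ

  module _ (cuboid : IsBipartiteCuboid Y) (φ : Y ≅ Z) where
    open _≅_ φ
    private
      module φ = Inverse edge
      module V₀  = Setoid Y.Vertex₀
      module V₀′ = Setoid Z.Vertex₀
      module V₁  = Setoid Y.Vertex₁
      module V₁′ = Setoid Z.Vertex₁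
      module I₀ = Inverse vertex₀
      module I₁ = Inverse vertex₁
      module Q₁ = IsQuotient MY.quotient₁

      reflect₀ : ∀ {e e′} → Func.to Z.end₀ (φ.to e) V₀′.≈ Func.to Z.end₀ (φ.to e′) →
                 Func.to Y.end₀ e V₀.≈ Func.to Y.end₀ e′
      reflect₀ {e} {e′} p = V₀.trans (V₀.sym (I₀.strictlyInverseʳ _)) (I₀.inverseʳ
        (V₀′.trans (V₀′.sym (end₀-comm e)) (V₀′.trans p (end₀-comm e′))))

      reflect₁ : ∀ {e e′} → Func.to Z.end₁ (φ.to e) V₁′.≈ Func.to Z.end₁ (φ.to e′) →
                 Func.to Y.end₁ e V₁.≈ Func.to Y.end₁ e′
      reflect₁ {e} {e′} p = V₁.trans (V₁.sym (I₁.strictlyInverseʳ _)) (I₁.inverseʳ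
        (V₁′.trans (V₁′.sym (end₁-comm e)) (V₁′.trans p (end₁-comm e′))))

      -- The images of e and e s share an end and `G₀` has at most the elements 1 and s, so the
      -- image of e s is that of e or its translate by s. In the former case injectivity gives e s =
      -- e, and `map-fixed` applies.
      preserves-s : ∀ e → φ.to (e MY.◃ s) E′.≈ φ.to e MZ.◃ s
      preserves-s e with IsQuotient.fibre MZ.quotient₀ {φ.to e} {φ.to (e MY.◃ s)}
        (V₀′.trans (end₀-comm e) (V₀′.trans
          (I₀.to-cong (V₀.sym (IsQuotient.invariant MY.quotient₀ e gen)))
          (V₀′.sym (end₀-comm (e MY.◃ s)))))
      ... | k , k∈G₀ , q with G₀-elements k∈G₀
      ...   | inj₂ k≈s = E′.trans (E′.sym q) (MZ.◃-congˡ k≈s)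
      ...   | inj₁ k≈ε = map-fixed MY.quotient₀ MZ.quotient₀ edge (λ k∈ → k∈) gen reflect₀
                (E.trans (E.sym (φ.strictlyInverseʳ _)) (φ.inverseʳ
                  (E′.trans (E′.sym q) (E′.trans (MZ.◃-congˡ k≈ε) (MZ.◃-identity (φ.to e))))))

      -- Sharing a vertex cannot tell u from u², so at a trivalent vertex the cyclic order decides.
      -- A univalent vertex forces e u = e.
      preserves-u : ∀ e → φ.to (e MY.◃ u) E′.≈ φ.to e MZ.◃ u
      preserves-u e with IsBipartiteCuboid.valency₁ cuboid (Func.to Y.end₁ e)
      ... | inj₁ one = map-fixed MY.quotient₁ MZ.quotient₁ edge (λ k∈ → k∈) gen reflect₁
        (valency-one one (e MY.◃ u , Q₁.invariant e gen) (e , V₁.refl))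
      ... | inj₂ three = proj₁ (Equivalence.to
          (MZ.cyclic _ (Compose.inverse three (Star₁-map φ v)) (star a) (star b) (star c))
          (Equivalence.to (cyclic-⇔ v three a b c)
            (Equivalence.from (MY.cyclic v three a b c) (E.refl , E.refl))))
        where
        v = Func.to Y.end₁ e
        star = Inverse.to (Star₁-map φ v)
        a b c : Setoid.Carrier (Y.Star₁ v)
        a = e , V₁.refl
        b = e MY.◃ u , Q₁.invariant e gen
        c = e MY.◃ (u ∙ u) , Q₁.invariant e (mul gen gen)

      equivariantFor : Subgroup
      equivariantFor = record
        { member    = λ g → ∀ e → φ.to (e MY.◃ g) E′.≈ φ.to e MZ.◃ g
        ; resp      = λ p h e → E′.trans (φ.to-cong (MY.◃-congˡ (≈-sym p)))
                                (E′.trans (h e) (MZ.◃-congˡ p))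
        ; ε-closed  = λ e → E′.trans (φ.to-cong (MY.◃-identity e)) (E′.sym (MZ.◃-identity (φ.to e)))
        ; ∙-closed  = λ {g} {h} p q e → E′.trans (φ.to-cong (MY.◃-assoc e g h))
            (E′.trans (q (e MY.◃ g)) (E′.trans (MZ.◃-congʳ h (p e)) (E′.sym (MZ.◃-assoc (φ.to e) g h))))
        ; ⁻¹-closed = λ {g} p e → E′.sym (MZ.◃-transpose g
            (E′.trans (E′.sym (p (e MY.◃ g ⁻¹))) (φ.to-cong (MY.◃-cancel⁻¹ e g))))
        }

    onEdge-equivariant : Equivariant MY.action MZ.action onEdge
    onEdge-equivariant e g = generated equivariantFor preserves-s preserves-u g e

    ≅⇒stabiliser : ∀ {r r′} → onEdge r E′.≈ r′ → MY.stabiliser r ≐ₛ MZ.stabiliser r′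
    ≅⇒stabiliser {r} {r′} p =
        (λ {g} q → E′.trans (MZ.◃-congʳ g (E′.sym p)) (E′.trans (E′.sym (onEdge-equivariant r g))
                     (E′.trans (φ.to-cong q) p)))
      , (λ {g} q → E.trans (E.sym (φ.strictlyInverseʳ _)) (φ.inverseʳ
          (E′.trans (onEdge-equivariant r g) (E′.trans (MZ.◃-congʳ g p) (E′.trans q (E′.sym p))))))

  module _ {r r′} (stab : MY.stabiliser r ≐ₛ MZ.stabiliser r′) where
    private
      there : ∀ g h → r MY.◃ g E.≈ r MY.◃ h → r′ MZ.◃ g E′.≈ r′ MZ.◃ h
      there g h p = MZ.stabiliser⇒agree g h (proj₁ stab (MY.agree⇒stabiliser g h p))

      back : ∀ g h → r′ MZ.◃ g E′.≈ r′ MZ.◃ h → r MY.◃ g E.≈ r MY.◃ h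
      back g h p = MY.stabiliser⇒agree g h (proj₂ stab (MZ.agree⇒stabiliser g h p))

      path : E.Carrier → Γ
      path e = proj₁ (MY.transitive r e)

      r◃path : ∀ e → r MY.◃ path e E.≈ e
      r◃path e = proj₂ (MY.transitive r e)

      path′ : E′.Carrier → Γ
      path′ e = proj₁ (MZ.transitive r′ e)

      r′◃path′ : ∀ e → r′ MZ.◃ path′ e E′.≈ e
      r′◃path′ e = proj₂ (MZ.transitive r′ e)

      to : E.Carrier → E′.Carrier
      to e = r′ MZ.◃ path e

      from : E′.Carrier → E.Carrier
      from e = r MY.◃ path′ e

      to-orbit : ∀ {e} g → e E.≈ r MY.◃ g → to e E′.≈ r′ MZ.◃ g
      to-orbit {e} g p = there (path e) g (E.trans (r◃path e) p)

      from-orbit : ∀ {e} g → e E′.≈ r′ MZ.◃ g → from e E.≈ r MY.◃ g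
      from-orbit {e} g p = back (path′ e) g (E′.trans (r′◃path′ e) p)

      edges : Inverse Y.Edge Z.Edge
      edges = record
        { to        = to
        ; from      = from
        ; to-cong   = λ {e} {e′} p → to-orbit (path e′) (E.trans p (E.sym (r◃path e′)))
        ; from-cong = λ {e} {e′} p → from-orbit (path′ e′) (E′.trans p (E′.sym (r′◃path′ e′)))
        ; inverse   = (λ {x} p → E′.trans (to-orbit (path′ x) p) (r′◃path′ x))
                    , (λ {x} p → E.trans (from-orbit (path x) p) (r◃path x))
        }

      equivariant : Equivariant MY.action MZ.action to
      equivariant e g = E′.trans
        (to-orbit (path e ∙ g) (E.trans (MY.◃-congʳ g (E.sym (r◃path e))) (E.sym (MY.◃-assoc r (path e) g))))
        (MZ.◃-assoc r′ (path e) g)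

      module F = Inverse edges
      vertices₁ = descend MY.quotient₁ MZ.quotient₁ edges equivariant
      comm₁ = descend-comm MY.quotient₁ MZ.quotient₁ edges equivariant

      star : ∀ v → Inverse (Y.Star₁ v) (Z.Star₁ (Inverse.to vertices₁ v))
      star v = record
        { to        = λ (e , p) → to e , V₁′.trans (comm₁ e) (Inverse.to-cong vertices₁ p)
        ; from      = λ (e , p) → from e , V₁.trans (V₁.sym (Inverse.strictlyInverseʳ vertices₁ _))
            (Inverse.inverseʳ vertices₁ (V₁′.trans (V₁′.sym (comm₁ (from e)))
              (V₁′.trans (Func.cong Z.end₁ (F.strictlyInverseˡ e)) p)))
        ; to-cong   = F.to-cong
        ; from-cong = F.from-cong
        ; inverse   = F.inverseˡ , F.inverseʳ
        }
        where
        module V₁  = Setoid Y.Vertex₁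
        module V₁′ = Setoid Z.Vertex₁

      to-⇔ : ∀ {a b} g → b E.≈ a MY.◃ g ⇔ to b E′.≈ to a MZ.◃ g
      to-⇔ {a} {b} g = mk⇔
        (λ p → E′.trans (F.to-cong p) (equivariant a g))
        (λ p → E.trans (E.sym (F.strictlyInverseʳ b)) (F.inverseʳ (E′.trans p (E′.sym (equivariant a g)))))

    -- The edge r g is sent to r′ g. Since r g = r h means that g h⁻¹ fixes r, equal stabilisers
    -- make this well defined and injective; transitivity on the two sides makes it total and onto.
    stabiliser⇒≅ : Σ (Y ≅ Z) λ φ → _≅_.onEdge φ r E′.≈ r′
    stabiliser⇒≅ = record
      { vertex₀   = descend MY.quotient₀ MZ.quotient₀ edges equivariant
      ; vertex₁   = vertices₁
      ; edge      = edges
      ; end₀-comm = descend-comm MY.quotient₀ MZ.quotient₀ edges equivariant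
      ; end₁-comm = comm₁
      ; cyclic-⇔  = λ v three a b c →
          Compose.equivalence (MY.cyclic v three a b c)
         (Compose.equivalence (to-⇔ u ×-⇔ to-⇔ (u ∙ u))
         (Symmetry.equivalence (MZ.cyclic _ (Compose.inverse three (star v)) 
           (Inverse.to (star v) a) (Inverse.to (star v) b) (Inverse.to (star v) c))))
      } , E′.trans (to-orbit ε (E.sym (MY.◃-identity r))) (MZ.◃-identity r′)

-- Valencies and cyclic orders from orbits

enumerate : ∀ {n} (A : Setoid 0ℓ 0ℓ) (f : Fin n → Setoid.Carrier A) →
            (∀ i j → Setoid._≈_ A (f i) (f j) → i ≡ j) → (∀ a → ∃ λ i → Setoid._≈_ A (f i) a) →
            Inverse (≡.setoid (Fin n)) A
enumerate A f injective surjective = Bijection⇒Inverse record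
  { to        = f
  ; cong      = λ { refl → Setoid.refl A }
  ; bijective = (λ {i} {j} → injective i j)
              , (λ a → proj₁ (surjective a) , λ { refl → proj₂ (surjective a) })
  }

three-distinct : ∀ {A : Setoid 0ℓ 0ℓ} → Inverse (≡.setoid (Fin 3)) A → ¬ (∀ x y → Setoid._≈_ A x y)
three-distinct I collapse with () ← ≡.trans (≡.sym (Inverse.strictlyInverseʳ I zero))
  (Inverse.inverseʳ I {x = suc zero} (collapse _ _))

⇔-cyclicOrder : ∀ {A : Setoid 0ℓ 0ℓ} {R R′ : (x y z : Setoid.Carrier A) → Set} →
                (∀ x y z → R x y z ⇔ R′ x y z) → IsCyclicOrder A R′ → IsCyclicOrder A R
⇔-cyclicOrder R⇔R′ order = record
  { cyclic     = λ p → from (R⇔R′ _ _ _) (cyclic (to (R⇔R′ _ _ _) p))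
  ; asymmetric = λ p q → asymmetric (to (R⇔R′ _ _ _) p) (to (R⇔R′ _ _ _) q)
  ; transitive = λ p q → from (R⇔R′ _ _ _) (transitive (to (R⇔R′ _ _ _) p) (to (R⇔R′ _ _ _) q))
  ; connected  = λ x≉y y≉z z≉x → Sum.map (from (R⇔R′ _ _ _)) (from (R⇔R′ _ _ _)) (connected x≉y y≉z z≉x)
  }
  where
  open IsCyclicOrder order
  open Equivalence using (to; from)

module _ {E V : Setoid 0ℓ 0ℓ} {A : RightAction E} {end : Func E V} where
  private
    module E = Setoid E
    module V = Setoid V
    module end = Func end
  open RightAction A

  Star : V.Carrier → Setoid 0ℓ 0ℓ
  Star v = On.setoid E (proj₁ {B = λ e → end.to e V.≈ v})

  module _ {g} (Q : IsQuotient A ⟨ g ⟩ end) where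
    open IsQuotient Q

    fixed⇒alone : ∀ {e e′} → e ◃ g E.≈ e → end.to e V.≈ end.to e′ → e E.≈ e′
    fixed⇒alone {e} fixed p with k , k∈ , q ← fibre p =
      E.trans (E.sym (⟨⟩-least (stabiliser e) fixed k∈)) q

    fixed⇒valency-one : ∀ v → section v ◃ g E.≈ section v → Inverse (≡.setoid (Fin 1)) (Star v)
    fixed⇒valency-one v fixed = enumerate (Star v) (λ _ → section v , to-section v)
      (λ { zero zero _ → refl })
      (λ (e , p) → zero , fixed⇒alone fixed (V.trans (to-section v) (V.sym p)))

  module _ (em : ExcludedMiddle 0ℓ) (Q : IsQuotient A G₀ end) where
    open IsQuotient Q

    quotient⇒valency₀ : ∀ v → Inverse (≡.setoid (Fin 1)) (Star v) ⊎ Inverse (≡.setoid (Fin 2)) (Star v)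
    quotient⇒valency₀ v with em {section v ◃ s E.≈ section v}
    ... | yes fixed = inj₁ (fixed⇒valency-one Q v fixed)
    ... | no  moved = inj₂ (enumerate (Star v) edge injective onto)
      where
      e = section v
      edge : Fin 2 → Setoid.Carrier (Star v)
      edge zero    = e , to-section v
      edge (suc _) = e ◃ s , V.trans (invariant e gen) (to-section v)
      injective : ∀ i j → proj₁ (edge i) E.≈ proj₁ (edge j) → i ≡ j
      injective zero       zero       _ = refl
      injective zero       (suc zero) p = ⊥-elim (moved (E.sym p))
      injective (suc zero) zero       p = ⊥-elim (moved p)
      injective (suc zero) (suc zero) _ = refl
      onto : ∀ a → ∃ λ i → proj₁ (edge i) E.≈ proj₁ a
      onto (f , p) with fibre (V.trans (to-section v) (V.sym p))
      ... | k , k∈ , q with G₀-elements k∈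
      ...   | inj₁ k≈ε = zero , E.trans (E.sym (E.trans (◃-congˡ k≈ε) (◃-identity e))) q
      ...   | inj₂ k≈s = suc zero , E.trans (◃-congˡ (≈-sym k≈s)) q

  module _ (Q : IsQuotient A G₁ end) where
    open IsQuotient Q

    G₁-fibre : ∀ {e e′} → end.to e V.≈ end.to e′ → e′ E.≈ e ⊎ e′ E.≈ e ◃ u ⊎ e′ E.≈ e ◃ (u ∙ u)
    G₁-fibre {e} p with k , k∈ , q ← fibre p with G₁-elements k∈
    ... | inj₁ k≈ε         = inj₁ (E.trans (E.sym q) (E.trans (◃-congˡ k≈ε) (◃-identity e)))
    ... | inj₂ (inj₁ k≈u)  = inj₂ (inj₁ (E.trans (E.sym q) (◃-congˡ k≈u)))
    ... | inj₂ (inj₂ k≈uu) = inj₂ (inj₂ (E.trans (E.sym q) (◃-congˡ k≈uu)))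

    ◃uu◃u : ∀ e → e ◃ (u ∙ u) ◃ u E.≈ e
    ◃uu◃u e = E.trans (E.sym (◃-assoc e (u ∙ u) u)) (E.trans (◃-congˡ u³) (◃-identity e))

    ◃u◃uu : ∀ e → e ◃ u ◃ (u ∙ u) E.≈ e
    ◃u◃uu e = E.trans (E.sym (◃-assoc e u (u ∙ u)))
             (E.trans (◃-congˡ (≈-trans (≈-sym (assoc u u u)) u³)) (◃-identity e))

    -- Together with `u-fixes′` this excludes orbits of size two: as 3 is prime, any coincidence
    -- among e, e u and e u² makes u fix e.
    u-fixes : ∀ {e} → e ◃ (u ∙ u) E.≈ e → e ◃ u E.≈ e
    u-fixes {e} p = E.trans (◃-congʳ u (E.sym p)) (◃uu◃u e)

    u-fixes′ : ∀ {e} → e ◃ u E.≈ e ◃ (u ∙ u) → e ◃ u E.≈ e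
    u-fixes′ {e} p = E.trans p (E.trans (◃-assoc e u u) (E.trans (◃-congʳ u p) (◃uu◃u e)))

    quotient⇒valency₁ : ExcludedMiddle 0ℓ →
      ∀ v → Inverse (≡.setoid (Fin 1)) (Star v) ⊎ Inverse (≡.setoid (Fin 3)) (Star v)
    quotient⇒valency₁ em v with em {section v ◃ u E.≈ section v}
    ... | yes fixed = inj₁ (fixed⇒valency-one Q v fixed)
    ... | no  moved = inj₂ (enumerate (Star v) edge injective onto)
      where
      e = section v
      edge : Fin 3 → Setoid.Carrier (Star v)
      edge zero          = e , to-section v
      edge (suc zero)    = e ◃ u , V.trans (invariant e gen) (to-section v)
      edge (suc (suc _)) = e ◃ (u ∙ u) , V.trans (invariant e (mul gen gen)) (to-section v)
      injective : ∀ i j → proj₁ (edge i) E.≈ proj₁ (edge j) → i ≡ j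
      injective zero             zero             _ = refl
      injective zero             (suc zero)       p = ⊥-elim (moved (E.sym p))
      injective zero             (suc (suc zero)) p = ⊥-elim (moved (u-fixes (E.sym p)))
      injective (suc zero)       zero             p = ⊥-elim (moved p)
      injective (suc zero)       (suc zero)       _ = refl
      injective (suc zero)       (suc (suc zero)) p = ⊥-elim (moved (u-fixes′ p))
      injective (suc (suc zero)) zero             p = ⊥-elim (moved (u-fixes p))
      injective (suc (suc zero)) (suc zero)       p = ⊥-elim (moved (u-fixes′ (E.sym p)))
      injective (suc (suc zero)) (suc (suc zero)) _ = refl
      onto : ∀ a → ∃ λ i → proj₁ (edge i) E.≈ proj₁ a
      onto (f , p) with G₁-fibre (V.trans (to-section v) (V.sym p))
      ... | inj₁ q        = zero , E.sym q
      ... | inj₂ (inj₁ q) = suc zero , E.sym q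
      ... | inj₂ (inj₂ q) = suc (suc zero) , E.sym q

    -- Valency three ensures that u moves every edge at v. Where u fixes x, the relation would hold
    -- of x, x, x and asymmetry would fail.
    quotient⇒cyclicOrder : ∀ v → Inverse (≡.setoid (Fin 3)) (Star v) →
      IsCyclicOrder (Star v) (λ (a , _) (b , _) (c , _) → b E.≈ a ◃ u × c E.≈ a ◃ (u ∙ u))
    quotient⇒cyclicOrder v three = record
      { cyclic     = λ {(x , _)} {(y , _)} {(z , _)} (p , q) →
            E.trans q (E.trans (◃-assoc x u u) (◃-congʳ u (E.sym p)))
          , E.trans (E.sym (◃u◃uu x)) (◃-congʳ (u ∙ u) (E.sym p))
      ; asymmetric = λ {x} (p , q) (p′ , _) →
          moved x (E.trans (E.sym p) (E.trans p′ (E.trans (◃-congʳ u q) (◃uu◃u (proj₁ x)))))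
      -- Vacuous: the shared third edge would be both x u² and x u, so u would fix x.
      ; transitive = λ {x} (_ , q) (p , _) → ⊥-elim (moved x (u-fixes′ (E.trans (E.sym p) q)))
      ; connected  = λ {x} {y} {z} → connected {x} {y} {z}
      }
      where
      moved : ∀ (x : Setoid.Carrier (Star v)) → ¬ (proj₁ x ◃ u E.≈ proj₁ x)
      moved (x , p) fixed = three-distinct three λ (y , q) (z , r) →
        E.trans (E.sym (fixed⇒alone Q fixed (V.trans p (V.sym q)))) (fixed⇒alone Q fixed (V.trans p (V.sym r)))
      Turns : (a b c : Setoid.Carrier (Star v)) → Set
      Turns (a , _) (b , _) (c , _) = b E.≈ a ◃ u × c E.≈ a ◃ (u ∙ u)
      connected : ∀ {x y z} → ¬ (proj₁ x E.≈ proj₁ y) → ¬ (proj₁ y E.≈ proj₁ z) → ¬ (proj₁ z E.≈ proj₁ x) →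
                  Turns x y z ⊎ Turns z y x
      connected {x , p} {y , q} {z , r} x≉y y≉z z≉x
        with G₁-fibre (V.trans p (V.sym q)) | G₁-fibre (V.trans p (V.sym r))
      ... | inj₁ e        | _             = ⊥-elim (x≉y (E.sym e))
      ... | _             | inj₁ f        = ⊥-elim (z≉x f)
      ... | inj₂ (inj₁ e) | inj₂ (inj₁ f) = ⊥-elim (y≉z (E.trans e (E.sym f)))
      ... | inj₂ (inj₁ e) | inj₂ (inj₂ f) = inj₁ (e , f)
      ... | inj₂ (inj₂ e) | inj₂ (inj₁ f) = inj₂
        ( E.trans e (E.trans (◃-assoc x u u) (◃-congʳ u (E.sym f)))
        , E.trans (E.sym (◃u◃uu x)) (◃-congʳ (u ∙ u) (E.sym f)))
      ... | inj₂ (inj₂ e) | inj₂ (inj₂ f) = ⊥-elim (y≉z (E.trans e (E.sym f)))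

-- Transitivity gives connectedness

module _ {Y : BipartiteGraph} (M : Monodromy Y) where
  open BipartiteGraph Y
  open Monodromy M
  private
    module E  = Setoid Edge
    module V₀ = Setoid Vertex₀
    module V₁ = Setoid Vertex₁
    module Q₀ = IsQuotient quotient₀
    module Q₁ = IsQuotient quotient₁
    open Func end₀ using () renaming (to to start; cong to start-cong)
    open Func end₁ using () renaming (to to finish)

    infix 4 _~_
    _~_ : (v w : V₀.Carrier ⊎ V₁.Carrier) → Set
    _~_ = EqClosure Adjacent

    ~-sym : ∀ {v w} → v ~ w → w ~ v
    ~-sym = EqClosure.symmetric Adjacent

    joins : ∀ e {v w} → start e V₀.≈ v → finish e V₁.≈ w → inj₁ v ~ inj₂ w
    joins e p q = EqClosure.return (joined e p q)

    ~-start : ∀ {v} e → start e V₀.≈ v → inj₁ (start e) ~ inj₁ v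
    ~-start e p = joins e V₀.refl V₁.refl ◅◅ ~-sym (joins e p V₁.refl)

    ~-edge : ∀ {e e′} → e E.≈ e′ → inj₁ (start e) ~ inj₁ (start e′)
    ~-edge p = ~-start _ (start-cong p)

    -- An edge and its translate by s share their end of type (0); an edge and its translate by u
    -- are joined through their common end of type (1). `generated` extends this to all of Γ.
    connects : Subgroup
    connects = record
      { member    = λ g → ∀ e → inj₁ (start e) ~ inj₁ (start (e ◃ g))
      ; resp      = λ p c e → c e ◅◅ ~-edge (◃-congˡ p)
      ; ε-closed  = λ e → ~-edge (E.sym (◃-identity e))
      ; ∙-closed  = λ {g} {h} c d e → c e ◅◅ d (e ◃ g) ◅◅ ~-edge (E.sym (◃-assoc e g h))
      ; ⁻¹-closed = λ {g} c e → ~-edge (E.sym (◃-cancel⁻¹ e g)) ◅◅ ~-sym (c (e ◃ g ⁻¹))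
      }

    connects-all : ∀ g → g ∈ member connects
    connects-all = generated connects
      (λ e → ~-start e (V₀.sym (Q₀.invariant e gen)))
      (λ e → joins e V₀.refl (V₁.sym (Q₁.invariant e gen)) ◅◅ ~-sym (joins (e ◃ u) V₀.refl V₁.refl))

    edges-connected : ∀ e e′ → inj₁ (start e) ~ inj₁ (start e′)
    edges-connected e e′ = connects-all (proj₁ (transitive e e′)) e ◅◅ ~-edge (proj₂ (transitive e e′))

    edgeAt : ∀ v → ∃ λ e → v ~ inj₁ (start e)
    edgeAt (inj₁ v) = Q₀.section v , ~-sym (~-start (Q₀.section v) (Q₀.to-section v))
    edgeAt (inj₂ v) = Q₁.section v , ~-sym (joins (Q₁.section v) V₀.refl (Q₁.to-section v))

  monodromy⇒connected : Connected
  monodromy⇒connected v w with e , p ← edgeAt v | e′ , q ← edgeAt w =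
    p ◅◅ edges-connected e e′ ◅◅ ~-sym q

  monodromy⇒isBipartiteCuboid : ExcludedMiddle 0ℓ → IsBipartiteCuboid Y
  monodromy⇒isBipartiteCuboid em = record
    { connected   = monodromy⇒connected
    ; valency₀    = quotient⇒valency₀ em quotient₀
    ; valency₁    = quotient⇒valency₁ quotient₁ em
    ; cyclicOrder = λ v three → ⇔-cyclicOrder (cyclic v three) (quotient⇒cyclicOrder quotient₁ v three)
    }

-- The action of Γ on cosets

module _ (G : Subgroup) where
  private
    Y = Ycomb G
    module C = Setoid (Cosets G)

  cosetAction : RightAction (Cosets G)
  cosetAction = record
    { _◃_        = _∙_
    ; ◃-cong     = λ {x} {y} {g} {h} p q → C.trans {x ∙ g} {y ∙ g} {y ∙ h}
                     (Cosets-actʳ G g p) (Cosets-reflexive G (∙-congˡ {y} q))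
    ; ◃-identity = λ x → Cosets-reflexive G (identityʳ x)
    ; ◃-assoc    = λ x g h → Cosets-reflexive G (≈-sym (assoc x g h))
    }

  orbitQuotient : ∀ K → IsQuotient cosetAction K (orbit G K)
  orbitQuotient K = record
    { surjective = λ v → v , O.refl {v}
    ; fibre      = λ p → p
    ; invariant  = λ e {k} k∈K → O.sym {e} {e ∙ k} (k , k∈K , C.refl {e ∙ k})
    }
    where module O = Setoid (Orbits G K)

  Ycomb-monodromy : Monodromy Y
  Ycomb-monodromy = record
    { action     = cosetAction
    ; transitive = λ x y → x ⁻¹ ∙ y , Cosets-reflexive G (≈-trans (≈-sym (assoc x (x ⁻¹) y))
                     (≈-trans (∙-congʳ {y} (inverseʳ x)) (identityˡ y)))
    ; quotient₀  = orbitQuotient G₀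
    ; quotient₁  = orbitQuotient G₁
    ; cyclic     = λ _ _ _ _ _ → mk⇔ (λ p → p) (λ p → p)
    }

-- The monodromy of a cuboid graph

module _ {Y : BipartiteGraph} (cuboid : IsBipartiteCuboid Y) where
  open BipartiteGraph Y
  open IsBipartiteCuboid cuboid
  private
    module E  = Setoid Edge
    module V₀ = Setoid Vertex₀
    module V₁ = Setoid Vertex₁
    open Func end₀ using () renaming (to to start; cong to start-cong)
    open Func end₁ using () renaming (to to finish; cong to finish-cong)

    -- Specifies σ e by a property; at a univalent vertex it is e itself. The enumerations in
    -- `valency₀` may differ between equal vertices, so that σ respects equality, and is an
    -- involution, follows from uniqueness of the edge specified.
    record Flip (e a : E.Carrier) : Set where
      field
        sameStart : start a V₀.≈ start e
        covers₀   : ∀ {f} → start f V₀.≈ start e → f E.≈ e ⊎ f E.≈ a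

    open Flip

    flip-resp : ∀ {e e′ a} → e E.≈ e′ → Flip e a → Flip e′ a
    flip-resp p F = record
      { sameStart = V₀.trans (sameStart F) (start-cong p)
      ; covers₀   = λ q → Sum.map₁ (λ r → E.trans r p) (covers₀ F (V₀.trans q (start-cong (E.sym p))))
      }

    flip-unique : ∀ {e a b} → Flip e a → Flip e b → a E.≈ b
    flip-unique F G with covers₀ F (sameStart G) | covers₀ G (sameStart F)
    ... | inj₂ b≈a | _        = E.sym b≈a
    ... | inj₁ _   | inj₂ a≈b = a≈b
    ... | inj₁ b≈e | inj₁ a≈e = E.trans a≈e (E.sym b≈e)

    flip-sym : ∀ {e a} → Flip e a → Flip a e
    flip-sym F = record
      { sameStart = V₀.sym (sameStart F)
      ; covers₀   = λ q → Sum.swap (covers₀ F (V₀.trans q (sameStart F)))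
      }

    flip : ∀ e → ∃ (Flip e)
    flip e with valency₀ (start e)
    ... | inj₁ one = e , record
      { sameStart = V₀.refl
      ; covers₀   = λ {f} q → inj₁ (valency-one one (f , q) (e , V₀.refl))
      }
    ... | inj₂ two = proj₁ (I.to (opposite i)) , record
      { sameStart = proj₂ (I.to (opposite i))
      ; covers₀   = λ {f} q → Sum.map
          (λ eq → E.trans (locate (f , q) eq) (I.strictlyInverseˡ (e , V₀.refl)))
          (locate (f , q))
          (two-indices i (I.from (f , q)))
      }
      where
      module I = Inverse two
      i = I.from (e , V₀.refl)
      locate : ∀ f {j} → I.from f ≡ j → proj₁ f E.≈ proj₁ (I.to j)
      locate f refl = E.sym (I.strictlyInverseˡ f)
      two-indices : ∀ (i j : Fin 2) → j ≡ i ⊎ j ≡ opposite i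
      two-indices zero       zero       = inj₁ refl
      two-indices zero       (suc zero) = inj₂ refl
      two-indices (suc zero) zero       = inj₂ refl
      two-indices (suc zero) (suc zero) = inj₁ refl

    σ : Func Edge Edge
    σ = record
      { to   = λ e → proj₁ (flip e)
      ; cong = λ {e} {e′} p → flip-unique (flip-resp p (proj₂ (flip e))) (proj₂ (flip e′))
      }

    σ² : ∀ e → Func.to σ (Func.to σ e) E.≈ e
    σ² e = flip-unique (proj₂ (flip (Func.to σ e))) (flip-sym (proj₂ (flip e)))

    -- The second alternative: a trivalent vertex, with a and b following e in the cyclic order.
    Shape : (e a b : E.Carrier) → Set
    Shape e a b = (a E.≈ e × b E.≈ e)
                ⊎ (e E.≉ a × a E.≉ b × b E.≉ e × HasValency₁ (finish e) 3 × Cyclic e a b)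

    -- The counterpart of `Flip` for τ. Recording both successors makes the property stable under
    -- rotation of e, a, b, and then τ³ = 1 follows from uniqueness.
    record Turn (e a b : E.Carrier) : Set where
      field
        finish₁ : finish a V₁.≈ finish e
        finish₂ : finish b V₁.≈ finish e
        covers  : ∀ {f} → finish f V₁.≈ finish e → f E.≈ e ⊎ f E.≈ a ⊎ f E.≈ b
        shape   : Shape e a b

    open Turn

    star-≈ : ∀ {v w} → v V₁.≈ w → Inverse (Star₁ v) (Star₁ w)
    star-≈ p = record
      { to        = λ (e , q) → e , V₁.trans q p
      ; from      = λ (e , q) → e , V₁.trans q (V₁.sym p)
      ; to-cong   = λ q → q
      ; from-cong = λ q → q
      ; inverse   = (λ q → q) , (λ q → q)
      }

    valency-≈ : ∀ {v w n} → v V₁.≈ w → HasValency₁ v n → HasValency₁ w n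
    valency-≈ p I = Compose.inverse I (star-≈ p)

    turn-resp : ∀ {e e′ a b} → e E.≈ e′ → Turn e a b → Turn e′ a b
    turn-resp {e} {e′} {a} {b} p T = record
      { finish₁ = V₁.trans (finish₁ T) (finish-cong p)
      ; finish₂ = V₁.trans (finish₂ T) (finish-cong p)
      ; covers  = λ q → Sum.map₁ (λ r → E.trans r p) (covers T (V₁.trans q (finish-cong (E.sym p))))
      ; shape   = shape-resp (shape T)
      }
      where
      shape-resp : Shape e a b → Shape e′ a b
      shape-resp (inj₁ (q , r)) = inj₁ (E.trans q p , E.trans r p)
      shape-resp (inj₂ (e≉a , a≉b , b≉e , three , c)) = inj₂
        ( (λ q → e≉a (E.trans p q)) , a≉b , (λ q → b≉e (E.trans q (E.sym p)))
        , valency-≈ (finish-cong p) three , Cyclic-resp p E.refl E.refl c)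

    turn-rotate : ∀ {e a b} → Turn e a b → Turn a b e
    turn-rotate {e} {a} {b} T = record
      { finish₁ = V₁.trans (finish₂ T) (V₁.sym (finish₁ T))
      ; finish₂ = V₁.sym (finish₁ T)
      ; covers  = λ q → rotate (covers T (V₁.trans q (finish₁ T)))
      ; shape   = shape-rotate (shape T)
      }
      where
      rotate : ∀ {A B C : Set} → A ⊎ B ⊎ C → B ⊎ C ⊎ A
      rotate (inj₁ x)        = inj₂ (inj₂ x)
      rotate (inj₂ (inj₁ x)) = inj₁ x
      rotate (inj₂ (inj₂ x)) = inj₂ (inj₁ x)
      shape-rotate : Shape e a b → Shape a b e
      shape-rotate (inj₁ (q , r)) = inj₁ (E.trans r (E.sym q) , E.sym q)
      shape-rotate (inj₂ (e≉a , a≉b , b≉e , three , c)) = inj₂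
        ( a≉b , b≉e , e≉a , valency-≈ (V₁.sym (finish₁ T)) three
        , IsCyclicOrder.cyclic (cyclicOrder _ three) {e , V₁.refl} {a , finish₁ T} {b , finish₂ T} c)

    module _ {v} (order : IsCyclicOrder (Star₁ v) (CyclicAt v)) where
      open IsCyclicOrder order

      private
        Edges : Set
        Edges = Setoid.Carrier (Star₁ v)

        -- If x and y agreed, exchanging them in the rotated triple y, z, x would give x, z, y,
        -- which asymmetry forbids.
        x≉y : ∀ (x y z : Edges) → CyclicAt v x y z → proj₁ x E.≉ proj₁ y
        x≉y x y z c p = asymmetric {y} {z} {x} c′ (Cyclic-resp (E.sym p) E.refl p c′)
          where
          c′ = cyclic {x} {y} {z} c

      cyclic-distinct : ∀ (x y z : Edges) → CyclicAt v x y z →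
                        proj₁ x E.≉ proj₁ y × proj₁ y E.≉ proj₁ z × proj₁ z E.≉ proj₁ x
      cyclic-distinct x y z c = x≉y x y z c , x≉y y z x c′ , x≉y z x y (cyclic {y} {z} {x} c′)
        where
        c′ = cyclic {x} {y} {z} c

    -- Distinctness and `covers` leave c and d to be a and b in some order; asymmetry excludes the
    -- exchanged order.
    turn-cyclic : ∀ {e a b c d} → Turn e a b → HasValency₁ (finish e) 3 →
                  finish c V₁.≈ finish e → finish d V₁.≈ finish e →
                  Cyclic e a b → Cyclic e c d → c E.≈ a × d E.≈ b
    turn-cyclic {e} {a} {b} {c} {d} T three p q eab ecd
      with cyclic-distinct (cyclicOrder _ three) (e , V₁.refl) (c , p) (d , q) ecd
         | covers T p | covers T q
    ... | e≉c , c≉d , d≉e | inj₁ r        | _             = ⊥-elim (e≉c (E.sym r))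
    ... | e≉c , c≉d , d≉e | _             | inj₁ r        = ⊥-elim (d≉e r)
    ... | e≉c , c≉d , d≉e | inj₂ (inj₁ r) | inj₂ (inj₁ t) = ⊥-elim (c≉d (E.trans r (E.sym t)))
    ... | e≉c , c≉d , d≉e | inj₂ (inj₁ r) | inj₂ (inj₂ t) = r , t
    ... | e≉c , c≉d , d≉e | inj₂ (inj₂ r) | inj₂ (inj₂ t) = ⊥-elim (c≉d (E.trans r (E.sym t)))
    ... | e≉c , c≉d , d≉e | inj₂ (inj₂ r) | inj₂ (inj₁ t) =
      ⊥-elim (asymmetric {A} {B} {X} (cyclic {X} {A} {B} eab) (Cyclic-resp E.refl r t ecd))
      where
      open IsCyclicOrder (cyclicOrder _ three)
      X A B : Setoid.Carrier (Star₁ (finish e))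
      X = e , V₁.refl
      A = a , finish₁ T
      B = b , finish₂ T

    turn-unique : ∀ {e a b c d} → Turn e a b → Turn e c d → a E.≈ c
    turn-unique T T′ with shape T | shape T′
    ... | inj₂ (_ , _ , _ , three , eab) | inj₂ (_ , _ , _ , _ , ecd) =
      E.sym (proj₁ (turn-cyclic T three (finish₁ T′) (finish₂ T′) eab ecd))
    ... | inj₁ (a≈e , b≈e) | _ = E.trans a≈e
      (E.sym (Sum.[ (λ p → p) , Sum.[ (λ p → E.trans p a≈e) , (λ p → E.trans p b≈e) ] ] (covers T (finish₁ T′))))
    ... | inj₂ _ | inj₁ (c≈e , d≈e) = E.trans
      (Sum.[ (λ p → p) , Sum.[ (λ p → E.trans p c≈e) , (λ p → E.trans p d≈e) ] ] (covers T′ (finish₁ T))) (E.sym c≈e)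

    turn : ∀ e → ∃ λ a → ∃ λ b → Turn e a b
    turn e with valency₁ (finish e)
    ... | inj₁ one = e , e , record
      { finish₁ = V₁.refl
      ; finish₂ = V₁.refl
      ; covers  = λ {f} q → inj₁ (valency-one one (f , q) (e , V₁.refl))
      ; shape   = inj₁ (E.refl , E.refl)
      }
    -- The enumeration of the star need not follow the cyclic order, so its two other edges are
    -- exchanged when it runs backwards.
    ... | inj₂ three = case orient of λ
      { (inj₁ c) → proj₁ a , proj₁ b , record
          { finish₁ = proj₂ a
          ; finish₂ = proj₂ b
          ; covers  = λ {f} q → cover (f , q)
          ; shape   = inj₂ (e≉a , a≉b , b≉e , three , c)
          }
      ; (inj₂ c) → proj₁ b , proj₁ a , record
          { finish₁ = proj₂ b
          ; finish₂ = proj₂ a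
          ; covers  = λ {f} q → Sum.map₂ Sum.swap (cover (f , q))
          ; shape   = inj₂ ((λ p → b≉e (E.sym p)) , (λ p → a≉b (E.sym p)) , (λ p → e≉a (E.sym p)) , three , c)
          }
      }
      where
      module I = Inverse three
      open IsCyclicOrder (cyclicOrder _ three) renaming (connected to oriented)
      rotate : Fin 3 → Fin 3
      rotate zero             = suc zero
      rotate (suc zero)       = suc (suc zero)
      rotate (suc (suc zero)) = zero
      i = I.from (e , V₁.refl)
      a b : Setoid.Carrier (Star₁ (finish e))
      a = I.to (rotate i)
      b = I.to (rotate (rotate i))
      locate : ∀ f {j} → I.from f ≡ j → proj₁ f E.≈ proj₁ (I.to j)
      locate f refl = E.sym (I.strictlyInverseˡ f)
      index : ∀ {j k} → proj₁ (I.to j) E.≈ proj₁ (I.to k) → j ≡ k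
      index p = ≡.trans (≡.sym (I.strictlyInverseʳ _)) (I.inverseʳ p)
      rotate-moves : ∀ i → i ≢ rotate i
      rotate-moves zero             ()
      rotate-moves (suc zero)       ()
      rotate-moves (suc (suc zero)) ()
      rotate³ : ∀ i → rotate (rotate (rotate i)) ≡ i
      rotate³ zero             = refl
      rotate³ (suc zero)       = refl
      rotate³ (suc (suc zero)) = refl
      three-indices : ∀ i j → j ≡ i ⊎ j ≡ rotate i ⊎ j ≡ rotate (rotate i)
      three-indices zero             zero             = inj₁ refl
      three-indices zero             (suc zero)       = inj₂ (inj₁ refl)
      three-indices zero             (suc (suc zero)) = inj₂ (inj₂ refl)
      three-indices (suc zero)       zero             = inj₂ (inj₂ refl)
      three-indices (suc zero)       (suc zero)       = inj₁ refl
      three-indices (suc zero)       (suc (suc zero)) = inj₂ (inj₁ refl)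
      three-indices (suc (suc zero)) zero             = inj₂ (inj₁ refl)
      three-indices (suc (suc zero)) (suc zero)       = inj₂ (inj₂ refl)
      three-indices (suc (suc zero)) (suc (suc zero)) = inj₁ refl
      to-i : proj₁ (I.to i) E.≈ e
      to-i = I.strictlyInverseˡ (e , V₁.refl)
      e≉a : e E.≉ proj₁ a
      e≉a p = rotate-moves i (index (E.trans to-i p))
      a≉b : proj₁ a E.≉ proj₁ b
      a≉b p = rotate-moves (rotate i) (index p)
      b≉e : proj₁ b E.≉ e
      b≉e p = rotate-moves (rotate (rotate i)) (≡.trans (index (E.trans p (E.sym to-i))) (≡.sym (rotate³ i)))
      cover : ∀ f → proj₁ f E.≈ e ⊎ proj₁ f E.≈ proj₁ a ⊎ proj₁ f E.≈ proj₁ b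
      cover f = Sum.map (λ eq → E.trans (locate f eq) to-i) (Sum.map (locate f) (locate f))
                        (three-indices i (I.from f))
      orient : Cyclic e (proj₁ a) (proj₁ b) ⊎ Cyclic e (proj₁ b) (proj₁ a)
      orient = Sum.map₂ (λ c → cyclic {a} {e , V₁.refl} {b} (cyclic {b} {a} {e , V₁.refl} c))
                        (oriented {e , V₁.refl} {a} {b} e≉a a≉b b≉e)

    next : E.Carrier → E.Carrier
    next e = proj₁ (turn e)

    turnAt : ∀ e → Turn e (next e) (proj₁ (proj₂ (turn e)))
    turnAt e = proj₂ (proj₂ (turn e))

    τ : Func Edge Edge
    τ = record
      { to   = next
      ; cong = λ {e} {e′} p → turn-unique (turn-resp p (turnAt e)) (turnAt e′)
      }

    second-≈ : ∀ e → proj₁ (proj₂ (turn e)) E.≈ next (next e)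
    second-≈ e = turn-unique (turn-rotate (turnAt e)) (turnAt (next e))

    τ³ : ∀ e → next (next (next e)) E.≈ e
    τ³ e = E.trans (Func.cong τ (E.sym (second-≈ e)))
      (turn-unique (turnAt _) (turn-rotate (turn-rotate (turnAt e))))

    open FreeProduct Edge σ τ σ² τ³
    open RightAction action

    ◃-uu : ∀ e → e ◃ (u ∙ u) E.≈ proj₁ (proj₂ (turn e))
    ◃-uu e = E.trans (◃-assoc e u u) (E.trans (◃-u (e ◃ u))
      (E.trans (Func.cong τ (◃-u e)) (E.sym (second-≈ e))))

    -- Invariance is required at all edges at once, since for a product at e it uses the second
    -- factor at a translate of e.
    invariant : ∀ {V : Setoid 0ℓ 0ℓ} {g} (end : Func Edge V) →
                (∀ e → Setoid._≈_ V (Func.to end (e ◃ g)) (Func.to end e)) →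
                ∀ e {k} → k ∈ member ⟨ g ⟩ → Setoid._≈_ V (Func.to end (e ◃ k)) (Func.to end e)
    invariant {V} end g-inv e k∈ = ⟨⟩-least fixing g-inv k∈ e
      where
      module V = Setoid V
      module end = Func end
      fixing : Subgroup
      fixing = record
        { member    = λ k → ∀ e → end.to (e ◃ k) V.≈ end.to e
        ; resp      = λ p h e → V.trans (end.cong (◃-congˡ (≈-sym p))) (h e)
        ; ε-closed  = λ e → end.cong (◃-identity e)
        ; ∙-closed  = λ {g} {h} p q e → V.trans (end.cong (◃-assoc e g h)) (V.trans (q (e ◃ g)) (p e))
        ; ⁻¹-closed = λ {g} p e → V.trans (V.sym (p (e ◃ g ⁻¹))) (end.cong (◃-cancel⁻¹ e g))
        }

    edgeAt₀ : ∀ v → ∃ λ e → start e V₀.≈ v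
    edgeAt₀ v with valency₀ v
    ... | inj₁ I = Inverse.to I zero
    ... | inj₂ I = Inverse.to I zero

    edgeAt₁ : ∀ v → ∃ λ e → finish e V₁.≈ v
    edgeAt₁ v with valency₁ v
    ... | inj₁ I = Inverse.to I zero
    ... | inj₂ I = Inverse.to I zero

    fibre₀ : ∀ {e e′} → start e V₀.≈ start e′ → ∃ λ k → k ∈ member G₀ × e ◃ k E.≈ e′
    fibre₀ {e} p with covers₀ (proj₂ (flip e)) (V₀.sym p)
    ... | inj₁ q = ε , unit , E.trans (◃-identity e) (E.sym q)
    ... | inj₂ q = s , gen , E.trans (◃-s e) (E.sym q)

    fibre₁ : ∀ {e e′} → finish e V₁.≈ finish e′ → ∃ λ k → k ∈ member G₁ × e ◃ k E.≈ e′
    fibre₁ {e} p with covers (turnAt e) (V₁.sym p)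
    ... | inj₁ q        = ε , unit , E.trans (◃-identity e) (E.sym q)
    ... | inj₂ (inj₁ q) = u , gen , E.trans (◃-u e) (E.sym q)
    ... | inj₂ (inj₂ q) = u ∙ u , mul gen gen , E.trans (◃-uu e) (E.sym q)

    Reachable : E.Carrier → V₀.Carrier ⊎ V₁.Carrier → Set
    Reachable e (inj₁ v) = ∃ λ g → start (e ◃ g) V₀.≈ v
    Reachable e (inj₂ v) = ∃ λ g → finish (e ◃ g) V₁.≈ v

    via₀ : ∀ {e g f} → start (e ◃ g) V₀.≈ start f → ∃ λ h → e ◃ h E.≈ f
    via₀ {e} {g} p with k , _ , q ← fibre₀ p = g ∙ k , E.trans (◃-assoc e g k) q

    via₁ : ∀ {e g f} → finish (e ◃ g) V₁.≈ finish f → ∃ λ h → e ◃ h E.≈ f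
    via₁ {e} {g} p with k , _ , q ← fibre₁ p = g ∙ k , E.trans (◃-assoc e g k) q

    -- Induction along a walk: the next edge shares a vertex with some translate of e, hence is
    -- itself a translate of e, and so its other end is reached too.
    reach : ∀ {e v w} → EqClosure Adjacent v w → Reachable e v → Reachable e w
    reach []* r = r
    reach (fwd (joined f p q) ∷* path) (g , r) with h , t ← via₀ (V₀.trans r (V₀.sym p)) =
      reach path (h , V₁.trans (finish-cong t) q)
    reach (bwd (joined f p q) ∷* path) (g , r) with h , t ← via₁ (V₁.trans r (V₁.sym q)) =
      reach path (h , V₀.trans (start-cong t) p)

    transitive : IsTransitive
    transitive e e′ with g , r ← reach (connected (inj₁ (start e)) (inj₁ (start e′)))
                                       (ε , start-cong (◃-identity e)) = via₀ r

    cyclic-u : ∀ v → HasValency₁ v 3 → ∀ ((a , _) (b , _) (c , _) : Setoid.Carrier (Star₁ v)) →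
               Cyclic a b c ⇔ (b E.≈ a ◃ u × c E.≈ a ◃ (u ∙ u))
    cyclic-u v three (a , p) (b , q) (c , r) with shape (turnAt a)
    -- In this shape `covers` leaves a single edge at the vertex, contradicting valency three.
    ... | inj₁ (t₁ , t₂) = ⊥-elim (three-distinct three λ (x , x∈) (y , y∈) →
        E.trans (alone x (V₁.trans x∈ (V₁.sym p))) (E.sym (alone y (V₁.trans y∈ (V₁.sym p)))))
      where
      alone : ∀ x → finish x V₁.≈ finish a → x E.≈ a
      alone x x∈ = Sum.[ (λ t → t) , Sum.[ (λ t → E.trans t t₁) , (λ t → E.trans t t₂) ] ] (covers (turnAt a) x∈)
    ... | inj₂ (_ , _ , _ , three′ , t) = mk⇔
      (λ abc → let b≈ , c≈ = turn-cyclic (turnAt a) three′ (V₁.trans q (V₁.sym p)) (V₁.trans r (V₁.sym p)) t abc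
               in E.trans b≈ (E.sym (◃-u a)) , E.trans c≈ (E.sym (◃-uu a)))
      (λ (b≈ , c≈) → Cyclic-resp E.refl (E.sym (E.trans b≈ (◃-u a))) (E.sym (E.trans c≈ (◃-uu a))) t)

  cuboid⇒monodromy : Monodromy Y
  cuboid⇒monodromy = record
    { action     = action
    ; transitive = transitive
    ; quotient₀  = record
      { surjective = edgeAt₀
      ; fibre      = fibre₀
      ; invariant  = invariant end₀ λ e → V₀.trans (start-cong (◃-s e)) (sameStart (proj₂ (flip e)))
      }
    ; quotient₁  = record
      { surjective = edgeAt₁
      ; fibre      = fibre₁
      ; invariant  = invariant end₁ λ e → V₁.trans (finish-cong (◃-u e)) (finish₁ (turnAt e))
      }
    ; cyclic     = cyclic-u
    }

-- Conjugation and stabilisers of cosets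

conjugate-cong : ∀ G {g h} → g ≈ h → conjugate g G ≐ₛ conjugate h G
conjugate-cong G p =
    (λ (k , k∈G , q) → k , k∈G , ≈-trans q (∙-cong (∙-congʳ {k} p) (⁻¹-cong p)))
  , (λ (k , k∈G , q) → k , k∈G , ≈-trans q (∙-cong (∙-congʳ {k} (≈-sym p)) (⁻¹-cong (≈-sym p))))

conjugation-cancel : ∀ x h → x ⁻¹ ∙ (x ∙ h ∙ x ⁻¹) ∙ x ⁻¹ ⁻¹ ≈ h
conjugation-cancel x h = begin
  x ⁻¹ ∙ (x ∙ h ∙ x ⁻¹) ∙ x ⁻¹ ⁻¹     ≈⟨ ∙-congʳ {x ⁻¹ ⁻¹} (assoc (x ⁻¹) (x ∙ h) (x ⁻¹)) ⟨
  x ⁻¹ ∙ (x ∙ h) ∙ x ⁻¹ ∙ x ⁻¹ ⁻¹     ≈⟨ assoc (x ⁻¹ ∙ (x ∙ h)) (x ⁻¹) (x ⁻¹ ⁻¹) ⟩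
  x ⁻¹ ∙ (x ∙ h) ∙ (x ⁻¹ ∙ x ⁻¹ ⁻¹)   ≈⟨ ∙-congˡ {x ⁻¹ ∙ (x ∙ h)} (inverseʳ (x ⁻¹)) ⟩
  x ⁻¹ ∙ (x ∙ h) ∙ ε                  ≈⟨ identityʳ (x ⁻¹ ∙ (x ∙ h)) ⟩
  x ⁻¹ ∙ (x ∙ h)                      ≈⟨ \\-leftDividesʳ x h ⟩
  h                                   ∎
  where open SetoidReasoning Γ-setoid

conjugation-cancel⁻¹ : ∀ x h → x ∙ (x ⁻¹ ∙ h ∙ x ⁻¹ ⁻¹) ∙ x ⁻¹ ≈ h
conjugation-cancel⁻¹ x h = begin
  x ∙ (x ⁻¹ ∙ h ∙ x ⁻¹ ⁻¹) ∙ x ⁻¹              ≈⟨ ∙-cong (∙-congʳ {x ⁻¹ ∙ h ∙ x ⁻¹ ⁻¹} (⁻¹-involutive x)) (≈-refl {x ⁻¹}) ⟨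
  x ⁻¹ ⁻¹ ∙ (x ⁻¹ ∙ h ∙ x ⁻¹ ⁻¹) ∙ x ⁻¹        ≈⟨ ∙-congˡ {x ⁻¹ ⁻¹ ∙ (x ⁻¹ ∙ h ∙ x ⁻¹ ⁻¹)} (⁻¹-involutive (x ⁻¹)) ⟨
  x ⁻¹ ⁻¹ ∙ (x ⁻¹ ∙ h ∙ x ⁻¹ ⁻¹) ∙ x ⁻¹ ⁻¹ ⁻¹  ≈⟨ conjugation-cancel (x ⁻¹) h ⟩
  h                                            ∎
  where open SetoidReasoning Γ-setoid

module _ (G : Subgroup) where
  private
    module M = Monodromy (Ycomb-monodromy G)

  Ycomb-stabiliser : ∀ x → M.stabiliser x ≐ₛ conjugate (x ⁻¹) G
  Ycomb-stabiliser x =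
      (λ {g} q → x ∙ g ∙ x ⁻¹ , q , ≈-sym (conjugation-cancel x g))
    , (λ {g} (h , h∈G , q) → resp G (≈-sym (≈-trans (∙-congʳ {x ⁻¹} (∙-congˡ {x} q)) (conjugation-cancel⁻¹ x h))) h∈G)

  root-stabiliser : M.stabiliser (rootEdge G) ≐ₛ G
  root-stabiliser = (λ {g} → resp G (to-g g)) , (λ {g} → resp G (≈-sym (to-g g)))
    where
    to-g : ∀ g → ε ∙ g ∙ ε ⁻¹ ≈ g
    to-g g = ≈-trans (∙-cong (identityˡ g) ε⁻¹≈ε) (identityʳ g)

-- Subgroups, pointed graphs and edge orbits

≅•-isEquivalence : IsEquivalence _≅•_
≅•-isEquivalence = record
  { refl  = λ {Y} → ≅-refl , Setoid.refl (Edge Y)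
  ; sym   = λ {_} {Z} (φ , p) → ≅-sym φ , Inverse.inverseʳ (_≅_.edge φ) (Setoid.sym (Edge Z) p)
  ; trans = λ {_} {_} {Z} (φ , p) (ψ , q) → ≅-trans φ ψ ,
              Setoid.trans (Edge Z) (Inverse.to-cong (_≅_.edge ψ) p) q
  }
  where
  open PointedBipartiteCuboidGraph using (graph)
  Edge : (Y : PointedBipartiteCuboidGraph) → Setoid 0ℓ 0ℓ
  Edge Y = BipartiteGraph.Edge (graph Y)

≐ₛ-isEquivalence : IsEquivalence _≐ₛ_
≐ₛ-isEquivalence = record { refl = ≐-refl ; sym = ≐-sym ; trans = ≐-trans }

module _ (em : ExcludedMiddle 0ℓ) where
  private
    isCuboid : ∀ G → IsBipartiteCuboid (Ycomb G)
    isCuboid G = monodromy⇒isBipartiteCuboid (Ycomb-monodromy G) em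

    pointedYcomb : Subgroup → PointedBipartiteCuboidGraph
    pointedYcomb G = pointed (Ycomb G) (isCuboid G) (rootEdge G)

  -- An automorphism carrying x to y is an isomorphism of one graph pointed at x with the same graph
  -- pointed at y, so the comparison of stabilisers applies.
  sameOrbit⇔stabiliser : ∀ G {x y} → SameOrbit (Ycomb G) x y ⇔
    Monodromy.stabiliser (Ycomb-monodromy G) x ≐ₛ Monodromy.stabiliser (Ycomb-monodromy G) y
  sameOrbit⇔stabiliser G = mk⇔
    (λ (φ , p) → ≅⇒stabiliser (Ycomb-monodromy G) (Ycomb-monodromy G) (isCuboid G) φ p)
    (stabiliser⇒≅ (Ycomb-monodromy G) (Ycomb-monodromy G))

  pointedYcomb-isBijection : IsBijection _≐ₛ_ _≅•_ pointedYcomb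
  pointedYcomb-isBijection = record
    { isInjection = record
      { isCongruent = record
        { cong           = λ {G} {H} p → stabiliser⇒≅ (Ycomb-monodromy G) (Ycomb-monodromy H)
            (≐-trans (root-stabiliser G) (≐-trans p (≐-sym (root-stabiliser H))))
        ; isEquivalence₁ = ≐ₛ-isEquivalence
        ; isEquivalence₂ = ≅•-isEquivalence
        }
      ; injective = λ {G} {H} (φ , p) → ≐-trans (≐-sym (root-stabiliser G)) (≐-trans
          (≅⇒stabiliser (Ycomb-monodromy G) (Ycomb-monodromy H) (isCuboid G) φ p)
          (root-stabiliser H))
      }
    ; surjective = λ (pointed Y cuboid r) →
        let M = cuboid⇒monodromy cuboid in
        -- The preimage of a pointed graph is the stabiliser of its root, which is also the
        -- stabiliser of the root of the coset graph it defines.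
        Monodromy.stabiliser M r , λ {G} p →
          stabiliser⇒≅ (Ycomb-monodromy G) M (≐-trans (root-stabiliser G) p)
    }

  edge-orbits↔conjugacyClass : ∀ G → Bijection (Edge/Aut (Ycomb G)) (ConjugacyClass G)
  edge-orbits↔conjugacyClass G = record
    { to        = λ x → M.stabiliser x , x ⁻¹ , Ycomb-stabiliser G x
    ; cong      = λ {x} {y} → Equivalence.to (sameOrbit⇔stabiliser G)
    ; bijective = (λ {x} {y} → Equivalence.from (sameOrbit⇔stabiliser G))
                -- The coset Gx has stabiliser x⁻¹Gx, so gGg⁻¹ comes from x = g⁻¹.
                , λ (H , g , H≐gGg⁻¹) → g ⁻¹ , λ {z} z~g⁻¹ →
                    ≐-trans (Equivalence.to (sameOrbit⇔stabiliser G) z~g⁻¹)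
                   (≐-trans (Ycomb-stabiliser G (g ⁻¹))
                   (≐-trans (conjugate-cong G (⁻¹-involutive g)) (≐-sym H≐gGg⁻¹)))
    }
    where module M = Monodromy (Ycomb-monodromy G)

  normal⇔transitive : ∀ G → IsNormal G ⇔ AutActsTransitively (Ycomb G)
  normal⇔transitive G = mk⇔
    (λ normal x y → Equivalence.from (sameOrbit⇔stabiliser G)
      (≐-trans (stabiliser≐G normal x) (≐-sym (stabiliser≐G normal y))))
    -- That x fixes the coset Gg unfolds to g x g⁻¹ ∈ G, so equal stabilisers of the root and of Gg
    -- give normality directly.
    (λ transitive g x∈G → proj₁ (Equivalence.to (sameOrbit⇔stabiliser G) (transitive (rootEdge G) g))
                                (proj₂ (root-stabiliser G) x∈G))
    where
    module M = Monodromy (Ycomb-monodromy G)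
    stabiliser≐G : IsNormal G → ∀ x → M.stabiliser x ≐ₛ G
    stabiliser≐G normal x = (λ {g} p → resp G (conjugation-cancel x g) (normal (x ⁻¹) p)) , normal x

theorem3p2 : ExcludedMiddle 0ℓ →
    (Σ[ isCuboid ∈ (∀ G → IsBipartiteCuboid (Ycomb G)) ]
    IsBijection _≐ₛ_ _≅•_ (λ G → pointed (Ycomb G) (isCuboid G) (rootEdge G)))
    × (∀ G → Bijection (Edge/Aut (Ycomb G)) (ConjugacyClass G))
    × (∀ G → IsNormal G ⇔ AutActsTransitively (Ycomb G))
theorem3p2 em = ((λ G → monodromy⇒isBipartiteCuboid (Ycomb-monodromy G) em) , pointedYcomb-isBijection em)
              , edge-orbits↔conjugacyClass em
              , normal⇔transitive em
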